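{- Let $n\geq 8$ and $1\leq g\leq n-1$. Then $c\kappa_{g+1}(FQ_n)=g(n+1)-\frac{1}{2}g(g+1)+1$.
   Context: The $n$-dimensional hypercube $Q_n$ has vertex set $\{0,1\}^n$, two vertices being adjacent iff their binary strings differ in exactly one position. The $n$-dimensional folded hypercube $FQ_n$ is obtained from $Q_n$ by adding the perfect matching $\{u\bar u : u\in V(Q_n)\}$, where $\bar u$ is the bitwise complement of $u$. For a non-complete connected graph $G$ and a positive integer $k$, a $k$-component cut is a vertex set whose deletion leaves a graph with at least $k$ components, and the $k$-component connectivity $c\kappa_k(G)$ is the minimum size of a $k$-component cut of $G$. -}

module Defs where

open import Data.Bool using (Bool; true; false; not; _xor_)
open import Data.Nat using (ℕ; zero; suc; _+_; _*_; _∸_; _/_)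
open import Data.Vec using (Vec; []; _∷_; map)
open import Data.List using (List; []; _∷_; _++_)
import Data.List as L
open import Data.Fin using (Fin)
open import Data.Sum using (_⊎_)
open import Data.Product using (Σ; _×_)
open import Relation.Binary.PropositionalEquality using (_≡_; _≢_)
open import Relation.Nullary using (¬_)

Vertex : ℕ → Set
Vertex n = Vec Bool n

allVertices : (n : ℕ) → List (Vertex n)
allVertices zero = [] ∷ []
allVertices (suc n) = L.map (true ∷_) (allVertices n) ++ L.map (false ∷_) (allVertices n)

hamming : ∀ {n} → Vertex n → Vertex n → ℕ
hamming [] [] = 0
hamming (true ∷ u) (true ∷ v) = hamming u v
hamming (false ∷ u) (false ∷ v) = hamming u v
hamming (true ∷ u) (false ∷ v) = suc (hamming u v)
hamming (false ∷ u) (true ∷ v) = suc (hamming u v)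

complement : ∀ {n} → Vertex n → Vertex n
complement = map not

AdjFQ : ∀ {n} → Vertex n → Vertex n → Set
AdjFQ u v = (hamming u v ≡ 1) ⊎ (v ≡ complement u)

VertexSet : ℕ → Set
VertexSet n = Vertex n → Bool

count : ∀ {A : Set} → (A → Bool) → List A → ℕ
count p [] = 0
count p (x ∷ xs) with p x
... | true = suc (count p xs)
... | false = count p xs

size : ∀ {n} → VertexSet n → ℕ
size {n} S = count S (allVertices n)

data Reach {n : ℕ} (S : VertexSet n) (u : Vertex n) : Vertex n → Set where
  here : S u ≡ false → Reach S u u
  step : ∀ {w v} → Reach S u w → AdjFQ w v → S v ≡ false → Reach S u v

AtLeastComponents : ∀ {n} → VertexSet n → ℕ → Set
AtLeastComponents {n} S k =
  Σ (Fin k → Vertex n) λ x →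
    ((i : Fin k) → S (x i) ≡ false) ×
    ((i j : Fin k) → i ≢ j → ¬ Reach S (x i) (x j))

IsComponentCut : ∀ {n} → ℕ → VertexSet n → Set
IsComponentCut k S = AtLeastComponents S k

ComponentConnectivityFQ≡ : ℕ → ℕ → ℕ → Set
ComponentConnectivityFQ≡ n k m =
  (Σ (VertexSet n) λ S → IsComponentCut k S × size S ≡ m) ×
  ((S : VertexSet n) → IsComponentCut k S → m Data.Nat.≤ size S)

{-# OPTIONS --safe #-}
module Submission where

-- Write f(m,k) = k m - k(k+1)/2 + 1; the claimed value is f(n+1,g).  Grouping the components of FQ_n - S
-- into two nonadjacent sets A, B with at least g vertices each, the lower bound becomes an isoperimetric
-- statement about colourings of the vertices by A, S, B without A-B edges.
--
-- In the cube Q_m, halving along a coordinate gives |S| ≥ f(m,|A|) and, for k ≤ m - 2, |S| ≥ f(m,k)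
-- whenever |A|, |B| ≥ k.
--
-- In FQ_n, |S| ≥ f(n+1,|A|) for every A: call two vertices related if their closed neighbourhoods meet, and
-- remove from A a vertex v with the fewest relatives in A.  If u is a relative of v, the closed
-- neighbourhood of v meets that of u in at most 2 vertices; any other relative of v contributes at most 1
-- more if it is related to u and at most 2 if not, and by minimality the latter are no more numerous
-- than the elements of A unrelated to v.  So at most |A| vertices of N[v] are lost.
--
-- This settles |A| ≤ n + 2.  If n + 3 ≤ |A| ≤ |B|, some splitting of FQ_n by x_i or x_i + x_j into two copies of
-- Q_{n-1} leaves at least 3 elements of A on both sides (otherwise A would consist of a centre and at
-- most n + 1 further vertices), and the cube bounds for the halves add up.
--
-- Equality holds for the neighbourhood of g neighbours of one vertex.

open import Defs
open import Data.Bool using (Bool; true; false; not; _∧_; _∨_; _xor_; if_then_else_)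
open import Data.Bool.Properties using (not-involutive; xor-assoc; xor-comm; xor-identityʳ; ∨-zeroʳ; ∧-identityʳ; ∧-zeroʳ)
open import Data.Empty using (⊥; ⊥-elim)
open import Data.Fin using (Fin; zero; suc; inject≤; toℕ; punchIn; punchOut)
open import Data.Fin.Properties as Finₚ using (any?; all?; injective⇒≤; ¬∀⟶∃¬; pigeonhole; punchIn-punchOut; punchInᵢ≢i; punchIn-injective)
open import Data.List using (_++_) renaming ([] to ⟨⟩; _∷_ to _▸_)
import Data.List as L
open import Data.Nat using (ℕ; zero; suc; _+_; _*_; _∸_; _^_; _⊓_; _/_; _≤_; _<_; z≤n; s≤s)
open import Data.Nat.DivMod using (m*n/n≡m)
open import Data.Nat.Properties
open import Data.Nat.Tactic.RingSolver using (solve; solve-∀)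
open import Data.Product using (∃; ∃₂; _×_; _,_; proj₁; proj₂)
open import Data.Sum using (_⊎_; inj₁; inj₂)
open import Data.Vec using ([]; _∷_; insertAt; lookup; map; replicate; tabulate; updateAt)
open import Data.Vec.Properties using (≡-dec; ∷-injectiveʳ; insertAt-lookup; insertAt-punchIn; lookup-map; lookup∘tabulate; lookup∘updateAt; lookup∘updateAt′; map-insertAt; tabulate-cong; tabulate∘lookup)
open import Function using (_∘_)
open import Relation.Binary.PropositionalEquality using (_≡_; _≢_; refl; sym; trans; cong; cong₂; subst; module ≡-Reasoning)
open import Relation.Nullary using (¬_; Dec; yes; no; does)
open import Relation.Nullary.Decidable using (¬?; dec-true; dec-false)

-- Derives x ≤ y from l ≤ r through the certificate y - x = (r - l) + d.
≤-by : ∀ {x y l r} d → l ≤ r → x + r + d ≡ y + l → x ≤ y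
≤-by {x} {y} {l} {r} d l≤r eq = +-cancelʳ-≤ r x y (begin
  x + r      ≤⟨ m≤m+n (x + r) d ⟩
  x + r + d  ≡⟨ eq ⟩
  y + l      ≤⟨ +-monoʳ-≤ y l≤r ⟩
  y + r      ∎)
  where open ≤-Reasoning

≤⇒+ : ∀ {m n} → m ≤ n → ∃ λ d → n ≡ m + d
≤⇒+ {m} {n} m≤n = n ∸ m , sym (m+[n∸m]≡n m≤n)

𝟙 : Bool → ℕ
𝟙 true  = 1
𝟙 false = 0

𝟙-pos : ∀ b → 1 ≤ 𝟙 b → b ≡ true
𝟙-pos true _ = refl

-- Sums and cardinalities over the vertex set.

Σv : ∀ {n} → (Vertex n → ℕ) → ℕ
Σv {zero}  f = f []
Σv {suc n} f = Σv (f ∘ (true ∷_)) + Σv (f ∘ (false ∷_))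

Σv-cong : ∀ {n} {f g : Vertex n → ℕ} → (∀ v → f v ≡ g v) → Σv f ≡ Σv g
Σv-cong {zero}  e = e []
Σv-cong {suc n} e = cong₂ _+_ (Σv-cong (e ∘ (true ∷_))) (Σv-cong (e ∘ (false ∷_)))

Σv-mono : ∀ {n} {f g : Vertex n → ℕ} → (∀ v → f v ≤ g v) → Σv f ≤ Σv g
Σv-mono {zero}  e = e []
Σv-mono {suc n} e = +-mono-≤ (Σv-mono (e ∘ (true ∷_))) (Σv-mono (e ∘ (false ∷_)))

+-interchange : ∀ a b c d → (a + b) + (c + d) ≡ (a + c) + (b + d)
+-interchange a b c d = solve (a ▸ b ▸ c ▸ d ▸ ⟨⟩)

Σv-+ : ∀ {n} (f g : Vertex n → ℕ) → Σv (λ v → f v + g v) ≡ Σv f + Σv g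
Σv-+ {zero}  f g = refl
Σv-+ {suc n} f g
  rewrite Σv-+ (f ∘ (true ∷_)) (g ∘ (true ∷_)) | Σv-+ (f ∘ (false ∷_)) (g ∘ (false ∷_))
  = +-interchange (Σv (f ∘ (true ∷_))) _ _ _

Σv-*ˡ : ∀ {n} k (f : Vertex n → ℕ) → Σv (λ v → k * f v) ≡ k * Σv f
Σv-*ˡ {zero}  k f = refl
Σv-*ˡ {suc n} k f
  rewrite Σv-*ˡ k (f ∘ (true ∷_)) | Σv-*ˡ k (f ∘ (false ∷_))
  = sym (*-distribˡ-+ k _ _)

Σv-0 : ∀ n → Σv {n} (λ _ → 0) ≡ 0
Σv-0 zero = refl
Σv-0 (suc n) rewrite Σv-0 n = refl

Σv-1 : ∀ n → Σv {n} (λ _ → 1) ≡ 2 ^ n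
Σv-1 zero = refl
Σv-1 (suc n) rewrite Σv-1 n = cong (2 ^ n +_) (sym (+-identityʳ _))

Σv-swap : ∀ {m n} (f : Vertex m → Vertex n → ℕ) →
  Σv (λ u → Σv (f u)) ≡ Σv (λ v → Σv (λ u → f u v))
Σv-swap {zero}  f = refl
Σv-swap {suc m} f
  rewrite Σv-swap (f ∘ (true ∷_)) | Σv-swap (f ∘ (false ∷_))
  = sym (Σv-+ (λ v → Σv (λ u → f (true ∷ u) v)) _)

term≤Σv : ∀ {n} (f : Vertex n → ℕ) v → f v ≤ Σv f
term≤Σv f []          = ≤-refl
term≤Σv f (true ∷ v)  = ≤-trans (term≤Σv (f ∘ (true ∷_)) v) (m≤m+n _ _)
term≤Σv f (false ∷ v) = ≤-trans (term≤Σv (f ∘ (false ∷_)) v) (m≤n+m _ _)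

Σv-pos : ∀ {n} (f : Vertex n → ℕ) → 1 ≤ Σv f → ∃ λ v → 1 ≤ f v
Σv-pos {zero}  f p = [] , p
Σv-pos {suc n} f p with Σv (f ∘ (true ∷_)) in eq
... | zero  = let v , q = Σv-pos (f ∘ (false ∷_)) p in false ∷ v , q
... | suc _ = let v , q = Σv-pos (f ∘ (true ∷_)) (subst (1 ≤_) (sym eq) (s≤s z≤n)) in true ∷ v , q

infix 4 _≟v_
_≟v_ : ∀ {n} (u v : Vertex n) → Dec (u ≡ v)
_≟v_ = ≡-dec Data.Bool._≟_

_==_ : ∀ {n} → Vertex n → Vertex n → Bool
u == v = does (u ≟v v)

==-refl : ∀ {n} (u : Vertex n) → (u == u) ≡ true
==-refl u with u ≟v u
... | yes _ = refl
... | no ne = ⊥-elim (ne refl)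

≢⇒==false : ∀ {n} {u v : Vertex n} → u ≢ v → (u == v) ≡ false
≢⇒==false {u = u} {v} ne with u ≟v v
... | yes p = ⊥-elim (ne p)
... | no _  = refl

Σv-δ : ∀ {n} (u : Vertex n) (f : Vertex n → ℕ) → Σv (λ v → 𝟙 (u == v) * f v) ≡ f u
Σv-δ []          f = +-identityʳ _
Σv-δ {suc n} (true ∷ u)  f = trans (cong₂ _+_ (Σv-δ u (f ∘ (true ∷_))) (Σv-0 n)) (+-identityʳ _)
Σv-δ {suc n} (false ∷ u) f = cong₂ _+_ (Σv-0 n) (Σv-δ u (f ∘ (false ∷_)))

Σv-𝟙== : ∀ {n} (u : Vertex n) → Σv (λ v → 𝟙 (u == v)) ≡ 1
Σv-𝟙== u = trans (Σv-cong (λ v → sym (*-identityʳ (𝟙 (u == v))))) (Σv-δ u (λ _ → 1))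

card : ∀ {n} → (Vertex n → Bool) → ℕ
card P = Σv (𝟙 ∘ P)

_∖_ : ∀ {n} → (Vertex n → Bool) → Vertex n → Vertex n → Bool
(P ∖ u) v = P v ∧ not (u == v)

card-∖ : ∀ {n} (P : Vertex n → Bool) u → P u ≡ true → card P ≡ suc (card (P ∖ u))
card-∖ P u Pu = trans (Σv-cong lem)
  (trans (Σv-+ (λ v → 𝟙 (u == v)) (𝟙 ∘ (P ∖ u))) (cong (_+ card (P ∖ u)) (Σv-𝟙== u)))
  where
  lem : ∀ v → 𝟙 (P v) ≡ 𝟙 (u == v) + 𝟙 ((P ∖ u) v)
  lem v with u ≟v v
  ... | yes refl rewrite Pu = refl
  ... | no _ with P v
  ...   | true  = refl
  ...   | false = refl

∖-other : ∀ {n} (P : Vertex n → Bool) u v → u ≢ v → P v ≡ true → (P ∖ u) v ≡ true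
∖-other P u v ne Pv rewrite Pv | ≢⇒==false ne = refl

injection⇒≤card : ∀ {n k} (P : Vertex n → Bool) (x : Fin k → Vertex n) →
  (∀ i → P (x i) ≡ true) → (∀ i j → i ≢ j → x i ≢ x j) → k ≤ card P
injection⇒≤card {k = zero}  P x Px inj = z≤n
injection⇒≤card {k = suc k} P x Px inj
  rewrite card-∖ P (x zero) (Px zero)
  = s≤s (injection⇒≤card (P ∖ x zero) (x ∘ suc)
      (λ i → ∖-other P (x zero) (x (suc i)) (inj zero (suc i) λ ()) (Px (suc i)))
      (λ i j ne → inj (suc i) (suc j) λ { refl → ne refl }))

card-≤1 : ∀ {n} (P : Vertex n → Bool) → (∀ u v → P u ≡ true → P v ≡ true → u ≡ v) → card P ≤ 1
card-≤1 {n} P unique with card P in eq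
... | zero  = z≤n
... | suc k with Σv-pos (𝟙 ∘ P) (subst (1 ≤_) (sym eq) (s≤s z≤n))
...   | u , Pu≥1 = ≤-trans (≤-reflexive (sym eq)) (≤-trans (Σv-mono bound) (≤-reflexive (Σv-𝟙== u)))
  where
  Pu : P u ≡ true
  Pu = 𝟙-pos (P u) Pu≥1
  bound : ∀ v → 𝟙 (P v) ≤ 𝟙 (u == v)
  bound v with P v in e
  ... | false = z≤n
  ... | true rewrite unique u v Pu e | ==-refl v = ≤-refl

-- Agreement of the list-based `size` with `card`.

count-++ : ∀ {X : Set} (p : X → Bool) xs ys → count p (xs ++ ys) ≡ count p xs + count p ys
count-++ p ⟨⟩       ys = refl
count-++ p (x ▸ xs) ys with p x
... | true  = cong suc (count-++ p xs ys)
... | false = count-++ p xs ys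

count-map : ∀ {X Y : Set} (p : Y → Bool) (f : X → Y) xs → count p (L.map f xs) ≡ count (p ∘ f) xs
count-map p f ⟨⟩       = refl
count-map p f (x ▸ xs) with p (f x)
... | true  = cong suc (count-map p f xs)
... | false = count-map p f xs

size≡card : ∀ {n} (S : VertexSet n) → size S ≡ card S
size≡card {zero} S with S []
... | true  = refl
... | false = refl
size≡card {suc n} S
  rewrite count-++ S (L.map (true ∷_) (allVertices n)) (L.map (false ∷_) (allVertices n))
        | count-map S (true ∷_) (allVertices n) | count-map S (false ∷_) (allVertices n)
  = cong₂ _+_ (size≡card (S ∘ (true ∷_))) (size≡card (S ∘ (false ∷_)))

-- Colourings of the vertices by A, S, B, where S separates A from B.

data Part : Set where
  inA inS inB : Part

swap : Part → Part
swap inA = inB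
swap inS = inS
swap inB = inA

isA isS isB : Part → Bool
isA inA = true
isA _   = false
isS inS = true
isS _   = false
isB inB = true
isB _   = false

#A #S #B : ∀ {n} → (Vertex n → Part) → ℕ
#A c = card (isA ∘ c)
#S c = card (isS ∘ c)
#B c = card (isB ∘ c)

#A-swap : ∀ {n} (c : Vertex n → Part) → #A (swap ∘ c) ≡ #B c
#A-swap c = Σv-cong λ v → lem (c v)
  where
  lem : ∀ p → 𝟙 (isA (swap p)) ≡ 𝟙 (isB p)
  lem inA = refl
  lem inS = refl
  lem inB = refl

#B-swap : ∀ {n} (c : Vertex n → Part) → #B (swap ∘ c) ≡ #A c
#B-swap c = Σv-cong λ v → lem (c v)
  where
  lem : ∀ p → 𝟙 (isB (swap p)) ≡ 𝟙 (isA p)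
  lem inA = refl
  lem inS = refl
  lem inB = refl

#S-swap : ∀ {n} (c : Vertex n → Part) → #S (swap ∘ c) ≡ #S c
#S-swap c = Σv-cong λ v → lem (c v)
  where
  lem : ∀ p → 𝟙 (isS (swap p)) ≡ 𝟙 (isS p)
  lem inA = refl
  lem inS = refl
  lem inB = refl

#A+#S+#B : ∀ {n} (c : Vertex n → Part) → #A c + #S c + #B c ≡ 2 ^ n
#A+#S+#B {n} c = trans (cong (_+ #B c) (sym (Σv-+ (𝟙 ∘ isA ∘ c) (𝟙 ∘ isS ∘ c))))
  (trans (sym (Σv-+ (λ v → 𝟙 (isA (c v)) + 𝟙 (isS (c v))) (𝟙 ∘ isB ∘ c)))
    (trans (Σv-cong λ v → lem (c v)) (Σv-1 n)))
  where
  lem : ∀ p → 𝟙 (isA p) + 𝟙 (isS p) + 𝟙 (isB p) ≡ 1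
  lem inA = refl
  lem inS = refl
  lem inB = refl

Separates : ∀ {n} → (Vertex n → Vertex n → Set) → (Vertex n → Part) → Set
Separates _~_ c = ∀ u v → u ~ v → c u ≡ inA → c v ≡ inB → ⊥

AdjQ : ∀ {n} → Vertex n → Vertex n → Set
AdjQ u v = hamming u v ≡ 1

hamming-sym : ∀ {n} (u v : Vertex n) → hamming u v ≡ hamming v u
hamming-sym []          []          = refl
hamming-sym (true ∷ u)  (true ∷ v)  = hamming-sym u v
hamming-sym (true ∷ u)  (false ∷ v) = cong suc (hamming-sym u v)
hamming-sym (false ∷ u) (true ∷ v)  = cong suc (hamming-sym u v)
hamming-sym (false ∷ u) (false ∷ v) = hamming-sym u v

hamming-refl : ∀ {n} (u : Vertex n) → hamming u u ≡ 0
hamming-refl []          = refl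
hamming-refl (true ∷ u)  = hamming-refl u
hamming-refl (false ∷ u) = hamming-refl u

swap-A : ∀ {p} → swap p ≡ inA → p ≡ inB
swap-A {inB} _ = refl

swap-B : ∀ {p} → swap p ≡ inB → p ≡ inA
swap-B {inA} _ = refl

Separates-swap : ∀ {n} {_~_ : Vertex n → Vertex n → Set} {c} → (∀ u v → u ~ v → v ~ u) →
  Separates _~_ c → Separates _~_ (swap ∘ c)
Separates-swap symm sep u v u~v cu cv = sep v u (symm u v u~v) (swap-B cv) (swap-A cu)

AdjQ-sym : ∀ {n} (u v : Vertex n) → AdjQ u v → AdjQ v u
AdjQ-sym u v h = trans (hamming-sym v u) h

-- Halving a separated cube along its first coordinate.

module Halves {n} (c : Vertex (suc n) → Part) (sep : Separates AdjQ c) where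
  c₀ c₁ : Vertex n → Part
  c₀ = c ∘ (false ∷_)
  c₁ = c ∘ (true ∷_)

  sep₀ : Separates AdjQ c₀
  sep₀ u v = sep (false ∷ u) (false ∷ v)

  sep₁ : Separates AdjQ c₁
  sep₁ u v = sep (true ∷ u) (true ∷ v)

  private
    A-bound : ∀ p q → (p ≡ inA → q ≡ inB → ⊥) → 𝟙 (isA p) ≤ 𝟙 (isA q) + 𝟙 (isS q)
    A-bound inA inA _ = ≤-refl
    A-bound inA inS _ = ≤-refl
    A-bound inA inB f = ⊥-elim (f refl refl)
    A-bound inS q   _ = z≤n
    A-bound inB q   _ = z≤n

    B-bound : ∀ p q → (q ≡ inA → p ≡ inB → ⊥) → 𝟙 (isB p) ≤ 𝟙 (isB q) + 𝟙 (isS q)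
    B-bound inB inB _ = ≤-refl
    B-bound inB inS _ = ≤-refl
    B-bound inB inA f = ⊥-elim (f refl refl)
    B-bound inS q   _ = z≤n
    B-bound inA q   _ = z≤n

  -- The halves are joined by a perfect matching, and the partner of a vertex of A is never in B.
  a₁≤ : #A c₁ ≤ #A c₀ + #S c₀
  a₁≤ = ≤-trans (Σv-mono λ u → A-bound _ _ (sep (true ∷ u) (false ∷ u) (cong suc (hamming-refl u))))
    (≤-reflexive (Σv-+ (𝟙 ∘ isA ∘ c₀) _))

  a₀≤ : #A c₀ ≤ #A c₁ + #S c₁
  a₀≤ = ≤-trans (Σv-mono λ u → A-bound _ _ (sep (false ∷ u) (true ∷ u) (cong suc (hamming-refl u))))
    (≤-reflexive (Σv-+ (𝟙 ∘ isA ∘ c₁) _))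

  b₁≤ : #B c₁ ≤ #B c₀ + #S c₀
  b₁≤ = ≤-trans (Σv-mono λ u → B-bound _ _ (sep (false ∷ u) (true ∷ u) (cong suc (hamming-refl u))))
    (≤-reflexive (Σv-+ (𝟙 ∘ isB ∘ c₀) _))

  b₀≤ : #B c₀ ≤ #B c₁ + #S c₁
  b₀≤ = ≤-trans (Σv-mono λ u → B-bound _ _ (sep (true ∷ u) (false ∷ u) (cong suc (hamming-refl u))))
    (≤-reflexive (Σv-+ (𝟙 ∘ isB ∘ c₁) _))

-- Vertex isoperimetry in the cube.

-- The bounds k m - k (k + 1) / 2 + 1 ≤ s appear doubled and with the subtraction moved across.
Bound : ℕ → ℕ → ℕ → Set
Bound m k s = 2 * (k * m) + 2 ≤ 2 * s + k * (k + 1)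

-- With a = i + 1 and b = j + 1, the sum f(m,a) + f(m,b) exceeds f(m+1,a+b) by (a - 1)(b - 1) = i j.
Bound-add : ∀ m i j s t → Bound m (suc i) s → Bound m (suc j) t → Bound (suc m) (suc i + suc j) (t + s)
Bound-add m i j s t p q = ≤-by (2 * (i * j)) (+-mono-≤ p q) (solve (m ▸ i ▸ j ▸ s ▸ t ▸ ⟨⟩))

-- Here f(m+1,k) - f(m,k) = k. This serves the case where A lies in one half: the other half then
-- contains at least |A| vertices of S.
Bound-suc : ∀ m k s t → Bound m k s → k ≤ t → Bound (suc m) k (s + t)
Bound-suc m k s t p q = ≤-by 0 (+-mono-≤ p (+-mono-≤ q q)) (solve (m ▸ k ▸ s ▸ t ▸ ⟨⟩))

-- a ↦ a m - a (a + 1) / 2 is symmetric about m - 1/2.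
Bound-anti : ∀ m a k s → k ≤ a → a + k + 1 ≤ 2 * m → Bound m a s → Bound m k s
Bound-anti m a k s k≤a q p with ≤⇒+ k≤a
-- For a = k + d, twice the difference f(m,a) - f(m,k) is d (2 m - (a + k + 1)).
... | d , refl = ≤-by 0 (+-mono-≤ p (*-monoʳ-≤ d q)) (identity m k d s)
  where
  identity : ∀ m k d s → 2 * (k * m) + 2 + (2 * s + (k + d) * (k + d + 1) + d * (2 * m)) + 0
                       ≡ 2 * s + k * (k + 1) + (2 * ((k + d) * m) + 2 + d * (k + d + k + 1))
  identity = solve-∀

-- Induction on the dimension: `Bound-add` if A meets both halves, `Bound-suc` with the matching
-- between the halves if it meets only one.
cube-expansion : ∀ {m} (c : Vertex m → Part) → Separates AdjQ c → 1 ≤ #A c → Bound m (#A c) (#S c)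
cube-expansion {zero} c sep 1≤a with c []
... | inA = ≤-refl
cube-expansion {suc m} c sep 1≤a = go (#A c₁) (#A c₀) refl refl 1≤a
  where
  open Halves c sep
  go : ∀ a₁ a₀ → a₁ ≡ #A c₁ → a₀ ≡ #A c₀ → 1 ≤ a₁ + a₀ → Bound (suc m) (a₁ + a₀) (#S c₁ + #S c₀)
  go (suc i) (suc j) e f _ = subst (Bound (suc m) (suc i + suc j)) (+-comm (#S c₀) (#S c₁))
    (Bound-add m i j (#S c₁) (#S c₀)
      (subst (λ a → Bound m a (#S c₁)) (sym e) (cube-expansion c₁ sep₁ (subst (1 ≤_) e (s≤s z≤n))))
      (subst (λ a → Bound m a (#S c₀)) (sym f) (cube-expansion c₀ sep₀ (subst (1 ≤_) f (s≤s z≤n)))))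
  go (suc i) zero e f _ rewrite +-identityʳ i =
    Bound-suc m (suc i) (#S c₁) (#S c₀)
      (subst (λ a → Bound m a (#S c₁)) (sym e) (cube-expansion c₁ sep₁ (subst (1 ≤_) e (s≤s z≤n))))
      (≤-trans (≤-reflexive e) (≤-trans a₁≤ (≤-reflexive (cong (_+ #S c₀) (sym f)))))
  go zero (suc j) e f _ = subst (Bound (suc m) (suc j)) (+-comm (#S c₀) (#S c₁))
    (Bound-suc m (suc j) (#S c₀) (#S c₁)
      (subst (λ a → Bound m a (#S c₀)) (sym f) (cube-expansion c₀ sep₀ (subst (1 ≤_) f (s≤s z≤n))))
      (≤-trans (≤-reflexive f) (≤-trans a₀≤ (≤-reflexive (cong (_+ #S c₁) (sym e))))))

-- If the minority colours of the two halves differ, S is about half of the cube.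
minority-sum : ∀ {a₀ b₀ s₀ a₁ b₁ s₁ H K} →
  a₀ + s₀ + b₀ ≡ H → a₁ + s₁ + b₁ ≡ H →
  a₀ ≤ a₁ + s₁ → a₁ ≤ a₀ + s₀ → b₀ ≤ b₁ + s₁ → b₁ ≤ b₀ + s₀ →
  K ≤ a₁ + a₀ → K ≤ b₁ + b₀ →
  K ≤ (a₀ ⊓ b₀) + (a₁ ⊓ b₁) ⊎ H ≤ (s₁ + s₀) + ((a₀ ⊓ b₀) + (a₁ ⊓ b₁))
minority-sum {a₀} {b₀} {s₀} {a₁} {b₁} {s₁} {H} {K} h₀ h₁ pa₀ pa₁ pb₀ pb₁ ka kb
  with ≤-total a₀ b₀ | ≤-total a₁ b₁
... | inj₁ p | inj₁ q rewrite m≤n⇒m⊓n≡m p | m≤n⇒m⊓n≡m q = inj₁ (≤-trans ka (≤-reflexive (+-comm a₁ a₀)))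
... | inj₂ p | inj₂ q rewrite m≥n⇒m⊓n≡n p | m≥n⇒m⊓n≡n q = inj₁ (≤-trans kb (≤-reflexive (+-comm b₁ b₀)))
-- The rarer colour is A in half 0 and B in half 1. Each frequent colour is at most the same colour
-- in the other half, where it is the rarer one, plus S there.
... | inj₁ p | inj₂ q rewrite m≤n⇒m⊓n≡m p | m≥n⇒m⊓n≡n q = inj₂ (*-cancelˡ-≤ 2 (begin
  2 * H                                       ≡⟨ solve (H ▸ ⟨⟩) ⟩
  H + H                                       ≡⟨ cong₂ _+_ (sym h₀) (sym h₁) ⟩
  (a₀ + s₀ + b₀) + (a₁ + s₁ + b₁)             ≤⟨ ≤-by 0 (+-mono-≤ pb₀ pa₁) (solve (a₀ ▸ s₀ ▸ b₀ ▸ a₁ ▸ s₁ ▸ b₁ ▸ ⟨⟩)) ⟩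
  2 * ((s₁ + s₀) + (a₀ + b₁))                 ∎))
  where open ≤-Reasoning
... | inj₂ p | inj₁ q rewrite m≥n⇒m⊓n≡n p | m≤n⇒m⊓n≡m q = inj₂ (*-cancelˡ-≤ 2 (begin
  2 * H                                       ≡⟨ solve (H ▸ ⟨⟩) ⟩
  H + H                                       ≡⟨ cong₂ _+_ (sym h₀) (sym h₁) ⟩
  (a₀ + s₀ + b₀) + (a₁ + s₁ + b₁)             ≤⟨ ≤-by 0 (+-mono-≤ pa₀ pb₁) (solve (a₀ ▸ s₀ ▸ b₀ ▸ a₁ ▸ s₁ ▸ b₁ ▸ ⟨⟩)) ⟩
  2 * ((s₁ + s₀) + (b₀ + a₁))                 ∎))
  where open ≤-Reasoning

-- Lowers two minority sizes to targets of prescribed sum `K`. The choice is greedy: `i` is `k₀` if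
-- this leaves at least `l` for `j`, and otherwise `j` is `l`.
split-≤ : ∀ l K {k₀ k₁} → l ≤ k₀ → l ≤ k₁ → l + l ≤ K → K ≤ k₀ + k₁ →
  ∃₂ λ i j → i + j ≡ K × l ≤ i × l ≤ j × i ≤ k₀ × j ≤ k₁
split-≤ l K {k₀} {k₁} p₀ p₁ ll q with ≤-total (k₀ + l) K
... | inj₁ r = let j , e = ≤⇒+ (≤-trans (m≤m+n k₀ l) r) in
  k₀ , j , sym e , p₀ , +-cancelˡ-≤ k₀ _ _ (≤-trans r (≤-reflexive e)) , ≤-refl ,
  +-cancelˡ-≤ k₀ _ _ (≤-trans (≤-reflexive (sym e)) q)
... | inj₂ r = let i , e = ≤⇒+ (≤-trans (m≤m+n l l) ll) in
  i , l , trans (+-comm i l) (sym e) , +-cancelˡ-≤ l _ _ (≤-trans ll (≤-reflexive e)) , ≤-refl ,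
  +-cancelˡ-≤ l _ _ (≤-trans (≤-reflexive (sym e)) (≤-trans r (≤-reflexive (+-comm k₀ l)))) , p₁

pow-quadratic : ∀ t → (4 + t) * (3 + t) + 2 * (1 + t) ≤ 2 ^ (4 + t)
pow-quadratic zero    = m≤m+n 14 2
pow-quadratic (suc t) = ≤-by (4 + 7 * t + t * t) (*-monoʳ-≤ 2 (pow-quadratic t)) (identity t (2 ^ (4 + t)))
  where
  identity : ∀ t p → (4 + (1 + t)) * (3 + (1 + t)) + 2 * (1 + (1 + t)) + 2 * p + (4 + 7 * t + t * t)
                   ≡ 2 * p + 2 * ((4 + t) * (3 + t) + 2 * (1 + t))
  identity = solve-∀

-- `(2 + m) * (1 + m)` is twice f(m+2,m), and f(m+2,k) increases in k up to m, so one threshold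
-- serves every k ≤ m.
top-Bound : ∀ m k s → k ≤ m → (2 + m) * (1 + m) ≤ 2 * s → Bound (2 + m) k s
top-Bound m k s k≤m p with ≤⇒+ k≤m
... | e , refl = ≤-trans (≤-by (e * e + 3 * e) z≤n (identity k e)) (+-monoˡ-≤ _ p)
  where
  identity : ∀ k e → 2 * (k * (2 + (k + e))) + 2 + 0 + (e * e + 3 * e) ≡ (2 + (k + e)) * (1 + (k + e)) + k * (k + 1) + 0
  identity = solve-∀

≤⊓ˡ : ∀ {i a b} → i ≤ a ⊓ b → i ≤ a
≤⊓ˡ {i} {a} {b} p = ≤-trans p (m⊓n≤m a b)

≤⊓ʳ : ∀ {i a b} → i ≤ a ⊓ b → i ≤ b
≤⊓ʳ {i} {a} {b} p = ≤-trans p (m⊓n≤n a b)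

Bound-swap : ∀ {m k n} {c : Vertex n → Part} → Bound m k (#S (swap ∘ c)) → Bound m k (#S c)
Bound-swap {m} {k} {c = c} = subst (Bound m k) (#S-swap c)

⊓≡0 : ∀ {a b} → a ⊓ b ≡ 0 → a ≡ 0 ⊎ b ≡ 0
⊓≡0 {zero}          _ = inj₁ refl
⊓≡0 {suc a} {zero}  _ = inj₂ refl

-- If one side is small, its expansion bound passes to `k` by `Bound-anti`. If both are large,
-- induction on the dimension brings S to the threshold of `top-Bound`.
cube-separation : ∀ t k → 1 ≤ k → k ≤ 1 + t → (c : Vertex (3 + t) → Part) → Separates AdjQ c →
  k ≤ #A c → k ≤ #B c → Bound (3 + t) k (#S c)
cube-separation t k 1≤k k≤ c sep k≤a k≤b with #A c ≤? 4 + t | #B c ≤? 4 + t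
-- `4 + t` is the largest |A| with |A| + k + 1 ≤ 2 (3 + t) for the extreme k = 1 + t.
... | yes a≤ | _ = Bound-anti (3 + t) (#A c) k (#S c) k≤a
        (≤-trans (+-monoˡ-≤ 1 (+-mono-≤ a≤ k≤)) (≤-reflexive (identity t)))
        (cube-expansion c sep (≤-trans 1≤k k≤a))
  where
  identity : ∀ t → 4 + t + (1 + t) + 1 ≡ 2 * (3 + t)
  identity = solve-∀
... | no _ | yes b≤ = Bound-swap {3 + t} {k} {c = c} (Bound-anti (3 + t) (#A (swap ∘ c)) k (#S (swap ∘ c))
        (≤-trans k≤b (≤-reflexive (sym (#A-swap c))))
        (≤-trans (+-monoˡ-≤ 1 (+-mono-≤ (≤-trans (≤-reflexive (#A-swap c)) b≤) k≤)) (≤-reflexive (identity t)))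
        (cube-expansion (swap ∘ c) (Separates-swap {_~_ = AdjQ} AdjQ-sym sep)
          (≤-trans (≤-trans 1≤k k≤b) (≤-reflexive (sym (#A-swap c))))))
  where
  identity : ∀ t → 4 + t + (1 + t) + 1 ≡ 2 * (3 + t)
  identity = solve-∀
-- In Q_3 both sides would have at least five of the eight vertices.
cube-separation zero k 1≤k k≤ c sep k≤a k≤b | no a> | no b> =
  ⊥-elim (<⇒≱ {8} {10} (m≤m+n 9 1) (begin
    10                    ≤⟨ +-mono-≤ (≰⇒> a>) (≰⇒> b>) ⟩
    #A c + #B c           ≤⟨ +-monoˡ-≤ (#B c) (m≤m+n (#A c) (#S c)) ⟩
    #A c + #S c + #B c    ≡⟨ #A+#S+#B c ⟩
    8                     ∎))
  where open ≤-Reasoning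
cube-separation (suc t) k 1≤k k≤ c sep k≤a k≤b | no a> | no b> = top-Bound (2 + t) k (#S c) k≤ claim
  where
  open Halves c sep
  k₀ k₁ : ℕ
  k₀ = #A c₀ ⊓ #B c₀
  k₁ = #A c₁ ⊓ #B c₁

  s₀ s₁ : ℕ
  s₀ = #S c₀
  s₁ = #S c₁

  top : Bound (3 + t) (1 + t) s₁ → 6 + t ≤ s₀ → (4 + t) * (3 + t) ≤ 2 * (s₁ + s₀)
  top p q = ≤-by 6 (+-mono-≤ p (*-monoʳ-≤ 2 q)) (identity t s₀ s₁)
    where
    identity : ∀ t s₀ s₁ → (4 + t) * (3 + t) + (2 * s₁ + (1 + t) * (1 + t + 1) + 2 * s₀) + 6
      ≡ 2 * (s₁ + s₀) + (2 * ((1 + t) * (3 + t)) + 2 + 2 * (6 + t))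
    identity = solve-∀

  top′ : Bound (3 + t) (1 + t) s₀ → 6 + t ≤ s₁ → (4 + t) * (3 + t) ≤ 2 * (s₁ + s₀)
  top′ p q = ≤-by 6 (+-mono-≤ p (*-monoʳ-≤ 2 q)) (identity t s₀ s₁)
    where
    identity : ∀ t s₀ s₁ → (4 + t) * (3 + t) + (2 * s₀ + (1 + t) * (1 + t + 1) + 2 * s₁) + 6
      ≡ 2 * (s₁ + s₀) + (2 * ((1 + t) * (3 + t)) + 2 + 2 * (6 + t))
    identity = solve-∀

  middle : ∀ i j → suc i + suc j ≡ 2 + t → Bound (3 + t) (suc i) s₀ → Bound (3 + t) (suc j) s₁ →
    (4 + t) * (3 + t) ≤ 2 * (s₁ + s₀)
  middle i j eq p q = ≤-by 0 (subst (λ k → Bound (4 + t) k (s₁ + s₀)) eq (Bound-add (3 + t) i j s₀ s₁ p q)) (identity t (s₁ + s₀))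
    where
    identity : ∀ t s → (4 + t) * (3 + t) + (2 * s + (2 + t) * (2 + t + 1)) + 0 ≡ 2 * s + (2 * ((2 + t) * (4 + t)) + 2)
    identity = solve-∀

  rec₀ : ∀ i → 1 ≤ i → i ≤ 1 + t → i ≤ k₀ → Bound (3 + t) i s₀
  rec₀ i 1≤i i≤ i≤k = cube-separation t i 1≤i i≤ c₀ sep₀ (≤⊓ˡ i≤k) (≤⊓ʳ {i} {#A c₀} i≤k)

  rec₁ : ∀ i → 1 ≤ i → i ≤ 1 + t → i ≤ k₁ → Bound (3 + t) i s₁
  rec₁ i 1≤i i≤ i≤k = cube-separation t i 1≤i i≤ c₁ sep₁ (≤⊓ˡ i≤k) (≤⊓ʳ {i} {#A c₁} i≤k)

  s₀-large : k₀ ≡ 0 → 6 + t ≤ s₀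
  s₀-large e with ⊓≡0 e
  ... | inj₁ a₀≡0 = ≤-trans (subst (λ a → 6 + t ≤ #A c₁ + a) a₀≡0 (≰⇒> a>))
        (≤-trans (≤-reflexive (+-identityʳ _)) (≤-trans a₁≤ (≤-reflexive (cong (_+ s₀) a₀≡0))))
  ... | inj₂ b₀≡0 = ≤-trans (subst (λ b → 6 + t ≤ #B c₁ + b) b₀≡0 (≰⇒> b>))
        (≤-trans (≤-reflexive (+-identityʳ _)) (≤-trans b₁≤ (≤-reflexive (cong (_+ s₀) b₀≡0))))

  s₁-large : k₁ ≡ 0 → 6 + t ≤ s₁
  s₁-large e with ⊓≡0 e
  ... | inj₁ a₁≡0 = ≤-trans (subst (λ a → 6 + t ≤ a + #A c₀) a₁≡0 (≰⇒> a>))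
        (≤-trans a₀≤ (≤-reflexive (cong (_+ s₁) a₁≡0)))
  ... | inj₂ b₁≡0 = ≤-trans (subst (λ b → 6 + t ≤ b + #B c₀) b₁≡0 (≰⇒> b>))
        (≤-trans b₀≤ (≤-reflexive (cong (_+ s₁) b₁≡0)))

  many : 2 + t ≤ k₀ + k₁ → (4 + t) * (3 + t) ≤ 2 * (s₁ + s₀)
  many q with k₀ in e₀ | k₁ in e₁
  -- A half without A or without B has at least `6 + t` vertices in S, inherited from the other
  -- half. This makes up for using the size `1 + t` there, the largest that the induction hypothesis
  -- admits.
  ... | zero  | l     = top (rec₁ (1 + t) (s≤s z≤n) ≤-refl
          (≤-trans (n≤1+n _) (≤-trans q (≤-reflexive (sym e₁))))) (s₀-large e₀)
  ... | suc l | zero  = top′ (rec₀ (1 + t) (s≤s z≤n) ≤-refl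
          (≤-trans (n≤1+n _) (≤-trans q (≤-reflexive (trans (+-identityʳ _) (sym e₀)))))) (s₁-large e₁)
  ... | suc l | suc r with split-≤ 1 (2 + t) (s≤s (z≤n {l})) (s≤s (z≤n {r})) (s≤s (s≤s z≤n)) q
  ...   | suc i , suc j , eq , _ , _ , i≤ , j≤ = middle i j eq
          (rec₀ (suc i) (s≤s z≤n) (+-cancelʳ-≤ 1 _ _ (≤-trans (+-monoʳ-≤ (suc i) (s≤s (z≤n {j}))) (≤-reflexive (trans eq (+-comm 1 (1 + t)))))) (≤-trans i≤ (≤-reflexive (sym e₀))))
          (rec₁ (suc j) (s≤s z≤n) (+-cancelˡ-≤ 1 _ _ (≤-trans (+-monoˡ-≤ (suc j) (s≤s (z≤n {i}))) (≤-reflexive eq))) (≤-trans j≤ (≤-reflexive (sym e₁))))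

  claim : (4 + t) * (3 + t) ≤ 2 * #S c
  claim with 2 + t ≤? k₀ + k₁
  ... | yes q = many q
  ... | no q with minority-sum {#A c₀} {#B c₀} {s₀} {#A c₁} {#B c₁} {s₁} {2 ^ (3 + t)} {2 + t}
                    (#A+#S+#B c₀) (#A+#S+#B c₁) a₀≤ a₁≤ b₀≤ b₁≤
                    (≤-trans (m≤n+m _ 4) (≰⇒> a>)) (≤-trans (m≤n+m _ 4) (≰⇒> b>))
  ...   | inj₁ q′ = ⊥-elim (q q′)
  -- The minorities total at most `1 + t`, so S has at least 2^(3+t) - (1 + t) vertices, and
  -- `pow-quadratic` applies.
  ...   | inj₂ h  = ≤-by 0 (+-mono-≤ (≤-trans (pow-quadratic t) (*-monoʳ-≤ 2 h)) (*-monoʳ-≤ 2 (≤-pred (≰⇒> q))))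
                      (identity t (s₁ + s₀) (k₀ + k₁))
    where
    identity : ∀ t s k → (4 + t) * (3 + t) + (2 * (s + k) + 2 * (1 + t)) + 0
      ≡ 2 * s + ((4 + t) * (3 + t) + 2 * (1 + t) + 2 * k)
    identity = solve-∀

cube-separation-≤ : ∀ {m k} → 1 ≤ k → 2 + k ≤ m → (c : Vertex m → Part) → Separates AdjQ c →
  k ≤ #A c → k ≤ #B c → Bound m k (#S c)
cube-separation-≤ {k = k} 1≤k 2+k≤m c with ≤⇒+ (≤-trans (+-monoʳ-≤ 2 1≤k) 2+k≤m)
... | t , refl = cube-separation t k 1≤k (+-cancelˡ-≤ 2 _ _ 2+k≤m) c

-- The closed neighbourhoods of FQ_n: the generators are 0, the all-ones vector and the unit vectors.

γ : ∀ {n} → Fin (2 + n) → Fin n → Bool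
γ zero          t = false
γ (suc zero)    t = true
γ (suc (suc s)) t = does (s Finₚ.≟ t)

nb : ∀ {n} → Fin (2 + n) → Vertex n → Vertex n
nb zero          u = u
nb (suc zero)    u = complement u
nb (suc (suc s)) u = updateAt u s not

lookup-nb : ∀ {n} k (u : Vertex n) t → lookup (nb k u) t ≡ γ k t xor lookup u t
lookup-nb zero          u t = refl
lookup-nb (suc zero)    u t = lookup-map t not u
lookup-nb (suc (suc s)) u t with s Finₚ.≟ t
... | yes refl = lookup∘updateAt s u
... | no s≢t   = lookup∘updateAt′ t s (s≢t ∘ sym) u

lookup-ext : ∀ {n} {u v : Vertex n} → (∀ t → lookup u t ≡ lookup v t) → u ≡ v
lookup-ext {u = u} {v} e = trans (sym (tabulate∘lookup u)) (trans (tabulate-cong e) (tabulate∘lookup v))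

parity : ∀ {k} → (Fin k → Bool) → Bool
parity {zero}  f = false
parity {suc k} f = f zero xor parity (f ∘ suc)

parity-cong : ∀ {k} {f g : Fin k → Bool} → (∀ r → f r ≡ g r) → parity f ≡ parity g
parity-cong {zero}  e = refl
parity-cong {suc k} e = cong₂ _xor_ (e zero) (parity-cong (e ∘ suc))

xor-interchange : ∀ a b c d → (a xor b) xor (c xor d) ≡ (a xor c) xor (b xor d)
xor-interchange false false c     d = refl
xor-interchange false true  false d = refl
xor-interchange false true  true  d = refl
xor-interchange true  false false d = refl
xor-interchange true  false true  d = not-involutive d
xor-interchange true  true  false d = sym (not-involutive d)
xor-interchange true  true  true  d = refl

parity-xor : ∀ {k} (f g : Fin k → Bool) → parity (λ r → f r xor g r) ≡ parity f xor parity g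
parity-xor {zero}  f g = refl
parity-xor {suc k} f g = trans (cong ((f zero xor g zero) xor_) (parity-xor (f ∘ suc) (g ∘ suc)))
  (xor-interchange (f zero) (g zero) _ _)

-- If all n unit vectors occurred, choosing an occurrence of each would inject `Fin n` into `Fin k`.
fresh-coordinate : ∀ {n k} → k < n → (p : Fin k → Fin (2 + n)) → ∃ λ t → ∀ r → p r ≢ suc (suc t)
fresh-coordinate {n} {k} k<n p with any? (λ t → all? (λ r → ¬? (p r Finₚ.≟ suc (suc t))))
... | yes found = found
... | no  none  = ⊥-elim (<⇒≱ k<n (injective⇒≤ {f = index} index-injective))
  where
  covered : ∀ t → ∃ λ r → ¬ ¬ (p r ≡ suc (suc t))
  covered t = ¬∀⟶∃¬ k _ (λ r → ¬? (p r Finₚ.≟ suc (suc t))) (λ f → none (t , f))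
  hit-by : ∀ t r → ¬ ¬ (p r ≡ suc (suc t)) → p r ≡ suc (suc t)
  hit-by t r nn with p r Finₚ.≟ suc (suc t)
  ... | yes e = e
  ... | no ne = ⊥-elim (nn ne)
  index : Fin n → Fin k
  index t = proj₁ (covered t)
  index-injective : ∀ {s t} → index s ≡ index t → s ≡ t
  index-injective {s} {t} e with trans (sym (hit-by s (index s) (proj₂ (covered s))))
    (trans (cong p e) (hit-by t (index t) (proj₂ (covered t))))
  ... | refl = refl

-- The only linear relation among the generators involves all of them.
relation⇒even : ∀ {n k} → k < n → (p : Fin k → Fin (2 + n)) → (∀ t → parity (λ r → γ (p r) t) ≡ false) →
  ∀ x → x ≢ zero → parity (λ r → does (p r Finₚ.≟ x)) ≡ false
relation⇒even k<n p rel zero x≢0 = ⊥-elim (x≢0 refl)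
-- At a coordinate whose unit vector does not occur, only the all-ones generator contributes.
relation⇒even {n} k<n p rel (suc zero) _ = trans (sym (parity-cong λ r → lem (p r) (proj₂ fresh r))) (rel t₀)
  where
  fresh = fresh-coordinate k<n p
  t₀ = proj₁ fresh
  lem : ∀ q → q ≢ suc (suc t₀) → γ q t₀ ≡ does (q Finₚ.≟ suc zero)
  lem zero          _ = refl
  lem (suc zero)    _ = refl
  lem (suc (suc s)) q≢ = dec-false (s Finₚ.≟ t₀) λ { refl → q≢ refl }
-- Coordinate `s` sees exactly the all-ones vector and its own unit vector; the former occurs evenly
-- by the preceding clause.
relation⇒even {n} {k} k<n p rel (suc (suc s)) _ = trans (trans (sym (cong (_xor even) ones)) (sym (parity-xor isOnes isUnit)))
    (trans (sym (parity-cong (λ r → lem (p r)))) (rel s))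
  where
  isOnes isUnit : Fin k → Bool
  isOnes r = does (p r Finₚ.≟ suc zero)
  isUnit r = does (p r Finₚ.≟ suc (suc s))
  even = parity isUnit
  ones : parity isOnes ≡ false
  ones = relation⇒even k<n p rel (suc zero) λ ()
  lem : ∀ q → γ q s ≡ does (q Finₚ.≟ suc zero) xor does (q Finₚ.≟ suc (suc s))
  lem zero           = refl
  lem (suc zero)     = refl
  lem (suc (suc s′)) = refl

module _ {n} (6<n : 6 < n) where

  private
    2<n : 2 < n
    2<n = ≤-trans (m≤m+n 3 4) 6<n

    G = Fin (2 + n)

  γ-injective : ∀ i j → (∀ t → γ i t ≡ γ j t) → i ≡ j
  γ-injective i j e with i Finₚ.≟ j
  ... | yes i≡j = i≡j
  ... | no i≢j = ⊥-elim (bad i j i≢j e)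
    where
    p : G → G → Fin 2 → G
    p i j zero    = i
    p i j (suc _) = j
    xx : ∀ {a b} → a ≡ b → a xor (b xor false) ≡ false
    xx {false} refl = refl
    xx {true}  refl = refl
    bad : ∀ i j → i ≢ j → (∀ t → γ i t ≡ γ j t) → ⊥
    bad zero zero ne e = ne refl
    bad zero (suc j) ne e with relation⇒even 2<n (p zero (suc j)) (λ t → xx (e t)) (suc j) (λ ())
    ... | q rewrite dec-true (suc j Finₚ.≟ suc j) refl with () ← q
    bad (suc i) j ne e with relation⇒even 2<n (p (suc i) j) (λ t → xx (e t)) (suc i) (λ ())
    ... | q rewrite dec-true (suc i Finₚ.≟ suc i) refl | dec-false (j Finₚ.≟ suc i) (ne ∘ sym) with () ← q

  nb-injective : ∀ i j u → nb i u ≡ nb j u → i ≡ j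
  nb-injective i j u e = γ-injective i j λ t →
    cancel (trans (sym (lookup-nb i u t)) (trans (cong (λ w → lookup w t) e) (lookup-nb j u t)))
    where
    cancel : ∀ {a b c} → a xor c ≡ b xor c → a ≡ b
    cancel {false} {false} _ = refl
    cancel {true}  {true}  _ = refl
    cancel {false} {true}  {false} ()
    cancel {false} {true}  {true}  ()
    cancel {true}  {false} {false} ()
    cancel {true}  {false} {true}  ()

  -- Each nonzero one of `i`, `j`, `k`, `l` occurs evenly among the six, so it equals `p` or `q`.
  -- Four distinct values do not fit into the three places `zero`, `p`, `q`.
  no-short-relation : ∀ (i j k l p q : G) → i ≢ j → i ≢ k → i ≢ l → j ≢ k → j ≢ l → k ≢ l →
    (∀ t → γ i t xor (γ j t xor (γ k t xor (γ l t xor (γ p t xor (γ q t xor false))))) ≡ false) → ⊥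
  no-short-relation i j k l p q ij ik il jk jl kl rel = distinct (pigeonhole (n<1+n 3) (λ x → proj₁ (place (four x) (four-even x))))
    where
    six : Fin 6 → G
    six zero = i
    six (suc zero) = j
    six (suc (suc zero)) = k
    six (suc (suc (suc zero))) = l
    six (suc (suc (suc (suc zero)))) = p
    six (suc (suc (suc (suc (suc _))))) = q

    four : Fin 4 → G
    four zero = i
    four (suc zero) = j
    four (suc (suc zero)) = k
    four (suc (suc (suc _))) = l

    spot : Fin 3 → G
    spot zero = zero
    spot (suc zero) = p
    spot (suc (suc _)) = q

    evens : ∀ x → x ≢ zero → parity (λ r → does (six r Finₚ.≟ x)) ≡ false
    evens = relation⇒even 6<n six rel

    four-even : ∀ x → four x ≢ zero → true xor (does (p Finₚ.≟ four x) xor (does (q Finₚ.≟ four x) xor false)) ≡ false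
    four-even zero ne with evens i ne
    ... | e rewrite dec-true (i Finₚ.≟ i) refl | dec-false (j Finₚ.≟ i) (ij ∘ sym) | dec-false (k Finₚ.≟ i) (ik ∘ sym)
                  | dec-false (l Finₚ.≟ i) (il ∘ sym) = e
    four-even (suc zero) ne with evens j ne
    ... | e rewrite dec-true (j Finₚ.≟ j) refl | dec-false (i Finₚ.≟ j) ij | dec-false (k Finₚ.≟ j) (jk ∘ sym)
                  | dec-false (l Finₚ.≟ j) (jl ∘ sym) = e
    four-even (suc (suc zero)) ne with evens k ne
    ... | e rewrite dec-true (k Finₚ.≟ k) refl | dec-false (i Finₚ.≟ k) ik | dec-false (j Finₚ.≟ k) jk
                  | dec-false (l Finₚ.≟ k) (kl ∘ sym) = e
    four-even (suc (suc (suc zero))) ne with evens l ne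
    ... | e rewrite dec-true (l Finₚ.≟ l) refl | dec-false (i Finₚ.≟ l) il | dec-false (j Finₚ.≟ l) jl
                  | dec-false (k Finₚ.≟ l) kl = e

    place : ∀ x → (x ≢ zero → true xor (does (p Finₚ.≟ x) xor (does (q Finₚ.≟ x) xor false)) ≡ false) →
      ∃ λ y → spot y ≡ x
    place x h with x Finₚ.≟ zero | p Finₚ.≟ x | q Finₚ.≟ x
    ... | yes e | _     | _     = zero , sym e
    ... | no _  | yes e | _     = suc zero , e
    ... | no _  | no _  | yes e = suc (suc zero) , e
    ... | no ne | no _  | no _  with () ← h ne

    four-injective : ∀ x y → four x ≡ four y → x ≡ y
    four-injective zero zero _ = refl
    four-injective zero (suc zero) e = ⊥-elim (ij e)
    four-injective zero (suc (suc zero)) e = ⊥-elim (ik e)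
    four-injective zero (suc (suc (suc zero))) e = ⊥-elim (il e)
    four-injective (suc zero) zero e = ⊥-elim (ij (sym e))
    four-injective (suc zero) (suc zero) e = refl
    four-injective (suc zero) (suc (suc zero)) e = ⊥-elim (jk e)
    four-injective (suc zero) (suc (suc (suc zero))) e = ⊥-elim (jl e)
    four-injective (suc (suc zero)) zero e = ⊥-elim (ik (sym e))
    four-injective (suc (suc zero)) (suc zero) e = ⊥-elim (jk (sym e))
    four-injective (suc (suc zero)) (suc (suc zero)) e = refl
    four-injective (suc (suc zero)) (suc (suc (suc zero))) e = ⊥-elim (kl e)
    four-injective (suc (suc (suc zero))) zero e = ⊥-elim (il (sym e))
    four-injective (suc (suc (suc zero))) (suc zero) e = ⊥-elim (jl (sym e))
    four-injective (suc (suc (suc zero))) (suc (suc zero)) e = ⊥-elim (kl (sym e))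
    four-injective (suc (suc (suc zero))) (suc (suc (suc zero))) e = refl

    distinct : (∃₂ λ x y → x Data.Fin.< y × proj₁ (place (four x) (four-even x)) ≡ proj₁ (place (four y) (four-even y))) → ⊥
    distinct (x , y , x<y , e) = Finₚ.<⇒≢ x<y (four-injective x y
      (trans (sym (proj₂ (place (four x) (four-even x))))
        (trans (cong spot e) (proj₂ (place (four y) (four-even y))))))

-- Closed neighbourhoods and their intersections.

does⇒ : ∀ {P : Set} (d : Dec P) → does d ≡ true → P
does⇒ (yes p) _ = p

near? : ∀ {n} (u w : Vertex n) → Dec (∃ λ k → nb k u ≡ w)
near? u w = any? (λ k → nb k u ≟v w)

near : ∀ {n} → Vertex n → Vertex n → Bool
near u w = does (near? u w)

near⇒nb : ∀ {n} {u w : Vertex n} → near u w ≡ true → ∃ λ k → nb k u ≡ w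
near⇒nb {u = u} {w} = does⇒ (near? u w)

nb⇒near : ∀ {n} (u : Vertex n) {w} k → nb k u ≡ w → near u w ≡ true
nb⇒near u {w} k e = dec-true (near? u w) (k , e)

card-pos : ∀ {n} (P : Vertex n → Bool) → 1 ≤ card P → ∃ λ v → P v ≡ true
card-pos P p = let v , q = Σv-pos (𝟙 ∘ P) p in v , 𝟙-pos (P v) q

card-∋ : ∀ {n} (P : Vertex n → Bool) v → P v ≡ true → 1 ≤ card P
card-∋ P v Pv = ≤-trans (≤-reflexive (cong 𝟙 (sym Pv))) (term≤Σv (𝟙 ∘ P) v)

inhabited : ∀ {n} → (Vertex n → Bool) → Bool
inhabited P = does (1 ≤? card P)

inhabited⇒∃ : ∀ {n} (P : Vertex n → Bool) → inhabited P ≡ true → ∃ λ v → P v ≡ true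
inhabited⇒∃ P e = card-pos P (does⇒ (1 ≤? card P) e)

∃⇒inhabited : ∀ {n} (P : Vertex n → Bool) v → P v ≡ true → inhabited P ≡ true
∃⇒inhabited P v Pv = dec-true (1 ≤? card P) (card-∋ P v Pv)

∧-true : ∀ {a b} → a ∧ b ≡ true → a ≡ true × b ≡ true
∧-true {true} {true} _ = refl , refl

true-∧ : ∀ {a b} → a ≡ true → b ≡ true → a ∧ b ≡ true
true-∧ refl refl = refl

𝟙-mono : ∀ {a b} → (a ≡ true → b ≡ true) → 𝟙 a ≤ 𝟙 b
𝟙-mono {false}        f = z≤n
𝟙-mono {true} {true}  f = ≤-refl
𝟙-mono {true} {false} f with () ← f refl

common : ∀ {n} → Vertex n → Vertex n → Vertex n → Bool
common u v w = near u w ∧ near v w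

-- What a further relative `u′` of `v` shares with N[v] beyond the part inside N[u].
outside : ∀ {n} → Vertex n → Vertex n → Vertex n → Vertex n → Bool
outside v u′ u w = common v u′ w ∧ not (near u w)

related : ∀ {n} → Vertex n → Vertex n → Bool
related u v = inhabited (common u v)

hit : ∀ {n} → (Vertex n → Bool) → Vertex n → Bool
hit A w = inhabited (λ u → A u ∧ near u w)

hit-intro : ∀ {n} {A : Vertex n → Bool} {u w} → A u ≡ true → near u w ≡ true → hit A w ≡ true
hit-intro {A = A} {u} {w} a e = ∃⇒inhabited (λ u → A u ∧ near u w) u (true-∧ a e)

hit-elim : ∀ {n} {A : Vertex n → Bool} {w} → hit A w ≡ true → ∃ λ u → A u ≡ true × near u w ≡ true
hit-elim {A = A} {w} e = let u , q = inhabited⇒∃ (λ u → A u ∧ near u w) e in u , ∧-true q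

∖-elim : ∀ {n} (P : Vertex n → Bool) u {v} → (P ∖ u) v ≡ true → P v ≡ true × u ≢ v
∖-elim P u {v} e = proj₁ (∧-true e) , λ { refl → lem (proj₂ (∧-true {P u} e)) }
  where
  lem : not (u == u) ≡ true → ⊥
  lem q rewrite ==-refl u with () ← q

argmin : ∀ {n} (P : Vertex n → Bool) (f : Vertex n → ℕ) v → P v ≡ true →
  ∃ λ m → P m ≡ true × (∀ u → P u ≡ true → f m ≤ f u)
argmin {n} P f v Pv = go (f v) v Pv ≤-refl
  where
  go : ∀ b v → P v ≡ true → f v ≤ b → ∃ λ m → P m ≡ true × (∀ u → P u ≡ true → f m ≤ f u)
  go zero    v Pv q = v , Pv , λ u _ → ≤-trans q z≤n
  go (suc b) v Pv q with 1 ≤? card (λ u → P u ∧ does (suc (f u) ≤? f v))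
  ... | no none = v , Pv , minimal
    where
    minimal : ∀ u → P u ≡ true → f v ≤ f u
    minimal u Pu with f v ≤? f u
    ... | yes p = p
    ... | no  p = ⊥-elim (none (card-∋ _ u (true-∧ Pu (dec-true (suc (f u) ≤? f v) (≰⇒> p)))))
  ... | yes some with card-pos _ some
  ...   | u , Pu< = let Pu , lt = ∧-true {P u} Pu< in
                    go b u Pu (≤-pred (≤-trans (does⇒ (suc (f u) ≤? f v) lt) q))

xor-transpose : ∀ a b {u v} → a xor v ≡ b xor u → a xor b ≡ v xor u
xor-transpose false false {false} refl = refl
xor-transpose false false {true}  refl = refl
xor-transpose false true  {false} refl = refl
xor-transpose false true  {true}  refl = refl
xor-transpose true  false {false} {true}  _ = refl
xor-transpose true  false {true}  {false} _ = refl
xor-transpose true  true  {false} {false} _ = refl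
xor-transpose true  true  {true}  {true}  _ = refl

-- Modulo 2 the hypotheses are γ_i + γ_j = v + u, γ_k + γ_l = v + u′ and γ_p + γ_q = u′ + u; in
-- their sum the vertices cancel.
nb-relation : ∀ {n} {u v u′ : Vertex n} {i j k l p q} → nb i v ≡ nb j u → nb k v ≡ nb l u′ → nb p u′ ≡ nb q u →
  ∀ t → γ i t xor (γ j t xor (γ k t xor (γ l t xor (γ p t xor (γ q t xor false))))) ≡ false
nb-relation {u = u} {v} {u′} {i} {j} {k} {l} {p} {q} e f g t = begin
  γ i t xor (γ j t xor (γ k t xor (γ l t xor (γ p t xor (γ q t xor false)))))
    ≡⟨ sym (xor-assoc (γ i t) (γ j t) _) ⟩
  (γ i t xor γ j t) xor (γ k t xor (γ l t xor (γ p t xor (γ q t xor false))))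
    ≡⟨ cong₂ _xor_ (diff i j e) (sym (xor-assoc (γ k t) (γ l t) _)) ⟩
  (x v xor x u) xor ((γ k t xor γ l t) xor (γ p t xor (γ q t xor false)))
    ≡⟨ cong ((x v xor x u) xor_) (cong₂ _xor_ (diff k l f) (sym (xor-assoc (γ p t) (γ q t) false))) ⟩
  (x v xor x u) xor ((x v xor x u′) xor ((γ p t xor γ q t) xor false))
    ≡⟨ cong (λ b → (x v xor x u) xor ((x v xor x u′) xor (b xor false))) (diff p q g) ⟩
  (x v xor x u) xor ((x v xor x u′) xor ((x u′ xor x u) xor false))
    ≡⟨ cycle (x u) (x v) (x u′) ⟩
  false ∎
  where
  open ≡-Reasoning
  x : Vertex _ → Bool
  x w = lookup w t
  diff : ∀ i j {v u} → nb i v ≡ nb j u → γ i t xor γ j t ≡ x v xor x u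
  diff i j {v} {u} e = xor-transpose (γ i t) (γ j t)
    (trans (sym (lookup-nb i v t)) (trans (cong x e) (lookup-nb j u t)))
  cycle : ∀ a b c → (b xor a) xor ((b xor c) xor ((c xor a) xor false)) ≡ false
  cycle false false false = refl
  cycle false false true  = refl
  cycle false true  false = refl
  cycle false true  true  = refl
  cycle true  false false = refl
  cycle true  false true  = refl
  cycle true  true  false = refl
  cycle true  true  true  = refl

-- Both equations say γ_i + γ_j = u + v modulo 2.
nb-transpose : ∀ {n} {u v : Vertex n} i j → nb i v ≡ nb j u → nb j v ≡ nb i u
nb-transpose {u = u} {v} i j e = lookup-ext λ t → trans (lookup-nb j v t)
  (trans (lem (γ i t) (γ j t) (trans (sym (lookup-nb i v t)) (trans (cong (λ w → lookup w t) e) (lookup-nb j u t))))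
    (sym (lookup-nb i u t)))
  where
  lem : ∀ a b {u v} → a xor v ≡ b xor u → b xor v ≡ a xor u
  lem false false e = e
  lem true  true  e = e
  lem false true {u} refl = not-involutive u
  lem true false {v = v} refl = sym (not-involutive v)

nb-cancel : ∀ {n} {u v : Vertex n} i → nb i v ≡ nb i u → v ≡ u
nb-cancel {u = u} {v} i e = lookup-ext λ t → lem (γ i t)
  (trans (sym (lookup-nb i v t)) (trans (cong (λ w → lookup w t) e) (lookup-nb i u t)))
  where
  lem : ∀ a {u v} → a xor v ≡ a xor u → v ≡ u
  lem false e = e
  lem true {false} {false} _ = refl
  lem true {true}  {true}  _ = refl

module _ {n} (6<n : 6 < n) where

  -- Both hypotheses write u + v as a sum of two generators; two essentially different ways would be
  -- a relation among four distinct generators.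
  common-unique : ∀ {u v : Vertex n} {i j k l} → u ≢ v → nb i v ≡ nb j u → nb k v ≡ nb l u → k ≡ i ⊎ (k ≡ j × l ≡ i)
  common-unique {u} {v} {i} {j} {k} {l} u≢v e f with k Finₚ.≟ i | k Finₚ.≟ j
  ... | yes k≡i | _        = inj₁ k≡i
  ... | no _    | yes refl = inj₂ (refl , nb-injective 6<n l i u (trans (sym f) (nb-transpose i j e)))
  ... | no k≢i  | no k≢j   with l Finₚ.≟ i | l Finₚ.≟ j
  ...   | yes refl | _    = ⊥-elim (k≢j (nb-injective 6<n k j v (trans f (sym (nb-transpose i j e)))))
  ...   | no _ | yes refl = ⊥-elim (k≢i (nb-injective 6<n k i v (trans f (sym e))))
  -- The generator 0, taken twice, pads the relation to length six.
  ...   | no l≢i | no l≢j = ⊥-elim (no-short-relation 6<n i j k l zero zero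
            (λ { refl → u≢v (sym (nb-cancel i e)) }) (k≢i ∘ sym) (l≢i ∘ sym) (k≢j ∘ sym) (l≢j ∘ sym)
            (λ { refl → u≢v (sym (nb-cancel k f)) })
            (nb-relation {u = u} {v} {u} {i} {j} {k} {l} {zero} {zero} e f refl))

  card-common≤2 : ∀ {u v : Vertex n} → u ≢ v → card (common v u) ≤ 2
  card-common≤2 {u} {v} u≢v with 1 ≤? card (common v u)
  ... | no none = ≤-trans (≤-pred (≰⇒> none)) z≤n
  ... | yes some with card-pos (common v u) some
  ...   | w , cw with near⇒nb {u = v} (proj₁ (∧-true cw)) | near⇒nb {u = u} (proj₂ (∧-true {near v w} cw))
  ...     | i , e | j , f = ≤-trans (Σv-mono bound) (≤-reflexive
              (trans (Σv-+ (λ x → 𝟙 (nb i v == x)) (λ x → 𝟙 (nb j v == x)))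
                (cong₂ _+_ (Σv-𝟙== (nb i v)) (Σv-𝟙== (nb j v)))))
    where
    bound : ∀ x → 𝟙 (common v u x) ≤ 𝟙 (nb i v == x) + 𝟙 (nb j v == x)
    bound x with common v u x in cx
    ... | false = z≤n
    ... | true with near⇒nb {u = v} (proj₁ (∧-true cx)) | near⇒nb {u = u} (proj₂ (∧-true {near v x} cx))
    ...   | k , refl | l , f′ with common-unique {u} {v} {i} {j} {k} {l} u≢v (trans e (sym f)) (sym f′)
    ...     | inj₁ refl rewrite ==-refl (nb k v) = s≤s z≤n
    ...     | inj₂ (refl , _) rewrite ==-refl (nb k v) = m≤n+m 1 _

  -- Three vertices that are pairwise at distance at most 2 have a common closed neighbour.
  card-outside≤1 : ∀ {u v u′ : Vertex n} → u ≢ v → u′ ≢ v → related u v ≡ true → related u′ u ≡ true →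
    card (outside v u′ u) ≤ 1
  card-outside≤1 {u} {v} {u′} u≢v u′≢v ruv ru′u = card-≤1 (outside v u′ u) unique
    where
    unpack : ∀ {x y w : Vertex n} → common x y w ≡ true → ∃₂ λ i j → nb i x ≡ w × nb j y ≡ w
    unpack {x} {y} {w} c =
      let i , e = near⇒nb {u = x} (proj₁ (∧-true c)) ; j , f = near⇒nb {u = y} (proj₂ (∧-true {near x w} c))
      in i , j , e , f
    not-true : ∀ {b} → not b ≡ true → b ≢ true
    not-true {false} _ ()
    unique : ∀ w x → outside v u′ u w ≡ true → outside v u′ u x ≡ true → w ≡ x
    unique w x ow ox
      with unpack {v} {u′} (proj₁ (∧-true ow)) | unpack {v} {u′} (proj₁ (∧-true ox))
         | unpack {u} {v} (proj₂ (inhabited⇒∃ (common u v) ruv)) | unpack {u′} {u} (proj₂ (inhabited⇒∃ (common u′ u) ru′u))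
    ... | k , l , refl , f | k′ , l′ , refl , f′ | j , i , e , e′ | p , q , g , g′
      with common-unique {u′} {v} {k} {l} {k′} {l′} u′≢v (sym f) (sym f′)
    ...   | inj₁ refl = refl
    -- Now `w` and `x` are the two common neighbours of `v` and `u′`. As both lie outside N[u], `k`
    -- and `k′` differ from `i` and `j`, so the triangle `u`, `v`, `u′` yields a relation of six
    -- generators, four of them distinct.
    ...   | inj₂ (refl , refl) = ⊥-elim (no-short-relation 6<n i j k k′ p q
              (λ { refl → u≢v (nb-cancel i (trans e (sym e′))) })
              (λ { refl → far-w j (sym ij) })
              (λ { refl → far-x j (sym ij) })
              (λ { refl → far-w i ji })
              (λ { refl → far-x i ji })
              (λ { refl → u′≢v (nb-cancel k f) })
              (nb-relation {u = u} {v} {u′} {i} {j} {k} {k′} {p} {q} ij (sym f) (trans g (sym g′))))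
      where
      ij : nb i v ≡ nb j u
      ij = trans e′ (sym e)
      ji : nb i u ≡ nb j v
      ji = sym (nb-transpose i j ij)
      far-w : ∀ m → nb m u ≡ nb k v → ⊥
      far-w m h = not-true (proj₂ (∧-true {common v u′ (nb k v)} ow)) (nb⇒near u m h)
      far-x : ∀ m → nb m u ≡ nb k′ v → ⊥
      far-x m h = not-true (proj₂ (∧-true {common v u′ (nb k′ v)} ox)) (nb⇒near u m h)

-- Expansion in the folded hypercube.

related-intro : ∀ {n} (u v w : Vertex n) → near u w ≡ true → near v w ≡ true → related u v ≡ true
related-intro u v w p q = ∃⇒inhabited (common u v) w (true-∧ p q)

card-complement : ∀ {n} (P Q : Vertex n → Bool) → card (λ y → P y ∧ not (Q y)) + card (λ y → P y ∧ Q y) ≡ card P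
card-complement P Q = trans (sym (Σv-+ (λ y → 𝟙 (P y ∧ not (Q y))) _)) (Σv-cong λ y → lem (P y) (Q y))
  where
  lem : ∀ p q → 𝟙 (p ∧ not q) + 𝟙 (p ∧ q) ≡ 𝟙 p
  lem false q     = refl
  lem true  false = refl
  lem true  true  = refl

module _ {n} (6<n : 6 < n) (A : Vertex n → Bool) where

  degree : Vertex n → ℕ
  degree x = card (λ y → A y ∧ related y x)

  -- The overlap is the part of N[v] that remains covered when `v` is removed from `A`.
  overlap≤ : ∀ v → A v ≡ true → (∀ u → A u ≡ true → degree v ≤ degree u) →
    card (λ w → near v w ∧ hit (A ∖ v) w) ≤ card A
  overlap≤ v Av minimal with 1 ≤? card (λ w → near v w ∧ hit (A ∖ v) w)
  ... | no none = ≤-trans (≤-pred (≰⇒> none)) z≤n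
  ... | yes some with card-pos _ some
  ...   | w₀ , both with ∧-true {near v w₀} both
  ...     | vw₀ , hit₀ with hit-elim {A = A ∖ v} {w₀} hit₀
  ...       | u , A′u , uw₀ = bound
    where
    Au : A u ≡ true
    Au = proj₁ (∖-elim A v A′u)
    u≢v : u ≢ v
    u≢v e = proj₂ (∖-elim A v A′u) (sym e)
    ruv : related u v ≡ true
    ruv = related-intro u v w₀ uw₀ vw₀
    P E K : Vertex n → Bool
    P y = A y ∧ related y v
    E y = P y ∧ not (related y u)
    K y = P y ∧ related y u

    cover : ∀ w → 𝟙 (near v w ∧ hit (A ∖ v) w) ≤ 𝟙 (common v u w) + card (λ y → (A ∖ v) y ∧ outside v y u w)
    cover w with near v w in vw | near u w in uw
    ... | false | _    = z≤n
    ... | true | true  = ≤-trans (𝟙-mono {hit (A ∖ v) w} {true} (λ _ → refl)) (m≤m+n 1 _)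
    ... | true | false with hit (A ∖ v) w in h
    ...   | false = z≤n
    ...   | true with hit-elim {A = A ∖ v} {w} h
    ...     | y , A′y , yw = card-∋ _ y (true-∧ {(A ∖ v) y} A′y lem)
      where
      lem : near y w ∧ true ≡ true
      lem rewrite yw = refl

    -- A relative `y` of `v` other than `u` costs one, and one more if it lies in `E`:
    -- `card-outside≤1` applies when `y` is related to `u`, `card-common≤2` when it is not.
    charge : ∀ y → Σv (λ w → 𝟙 ((A ∖ v) y ∧ outside v y u w)) ≤ 𝟙 (((P ∖ v) ∖ u) y) + 𝟙 (E y)
    charge y with (A ∖ v) y in A′y
    ... | false = ≤-trans (≤-reflexive (Σv-0 n)) z≤n
    ... | true with y ≟v u
    ...   | yes refl = ≤-trans (Σv-mono λ w → ≤-reflexive (cong 𝟙 (lem (near v w) (near y w)))) (≤-trans (≤-reflexive (Σv-0 n)) z≤n)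
      where
      lem : ∀ a b → (a ∧ b) ∧ not b ≡ false
      lem false b     = refl
      lem true  false = refl
      lem true  true  = refl
    ...   | no y≢u with related y v in ryv
    ...     | false = ≤-trans (≤-pred (≰⇒> unrelated)) z≤n
      where
      unrelated : ¬ 1 ≤ card (outside v y u)
      unrelated p with card-pos (outside v y u) p
      ... | w , o with ∧-true {near v w} (proj₁ (∧-true o))
      ...   | vw , yw with trans (sym (related-intro y v w yw vw)) ryv
      ...     | ()
    ...     | true with related y u in ryu
    ...       | true = ≤-trans (card-outside≤1 6<n {u} {v} {y} u≢v y≢v ruv ryu) (≤-trans (≤-reflexive (cong 𝟙 (sym inP))) (m≤m+n _ _))
      where
      y≢v : y ≢ v
      y≢v e = proj₂ (∖-elim A v A′y) (sym e)
      inP : ((A y ∧ true) ∧ not (v == y)) ∧ not (u == y) ≡ true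
      inP rewrite proj₁ (∖-elim A v A′y) | ≢⇒==false (y≢v ∘ sym) | ≢⇒==false (y≢u ∘ sym) = refl
    ...       | false = ≤-trans (Σv-mono λ w → 𝟙-mono (λ o → proj₁ (∧-true {common v y w} o)))
                (≤-trans (card-common≤2 6<n y≢v) (+-mono-≤ (≤-reflexive (cong 𝟙 (sym inP))) (≤-reflexive (cong 𝟙 (sym inE)))))
      where
      y≢v : y ≢ v
      y≢v e = proj₂ (∖-elim A v A′y) (sym e)
      inP : ((A y ∧ true) ∧ not (v == y)) ∧ not (u == y) ≡ true
      inP rewrite proj₁ (∖-elim A v A′y) | ≢⇒==false (y≢v ∘ sym) | ≢⇒==false (y≢u ∘ sym) = refl
      inE : (A y ∧ true) ∧ true ≡ true
      inE rewrite proj₁ (∖-elim A v A′y) = refl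

    Pv : P v ≡ true
    Pv = true-∧ Av (related-intro v v v (nb⇒near v zero refl) (nb⇒near v zero refl))

    card-P : degree v ≡ 2 + card ((P ∖ v) ∖ u)
    card-P = trans (card-∖ P v Pv) (cong suc (card-∖ (P ∖ v) u (∖-other P v u (u≢v ∘ sym) (true-∧ Au ruv))))

    -- `K` consists of the relatives of both `u` and `v`. Removing it from both sides of
    -- `degree v ≤ degree u` gives |E| ≤ |E′|, and `E′` consists of elements of `A` unrelated to
    -- `v`.
    E≤ : card E + degree v ≤ card A
    E≤ = begin
      card E + degree v                             ≤⟨ +-monoˡ-≤ (degree v) (+-cancelʳ-≤ (card K) (card E) (card E′) EK≤E′K) ⟩
      card E′ + degree v                            ≤⟨ +-monoˡ-≤ (degree v) (Σv-mono λ y → weaken (A y) (related y u) (not (related y v))) ⟩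
      card (λ y → A y ∧ not (related y v)) + degree v ≡⟨ card-complement A (λ y → related y v) ⟩
      card A                                        ∎
      where
      open ≤-Reasoning
      E′ : Vertex n → Bool
      E′ y = (A y ∧ related y u) ∧ not (related y v)
      weaken : ∀ a b c → 𝟙 ((a ∧ b) ∧ c) ≤ 𝟙 (a ∧ c)
      weaken false b     c = z≤n
      weaken true  false c = z≤n
      weaken true  true  c = ≤-refl
      shuffle : ∀ a b c → 𝟙 ((a ∧ b) ∧ c) ≡ 𝟙 ((a ∧ c) ∧ b)
      shuffle false b     c     = refl
      shuffle true  false false = refl
      shuffle true  false true  = refl
      shuffle true  true  false = refl
      shuffle true  true  true  = refl
      EK≤E′K : card E + card K ≤ card E′ + card K
      EK≤E′K = begin
        card E + card K    ≡⟨ card-complement P (λ y → related y u) ⟩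
        degree v           ≤⟨ minimal u Au ⟩
        degree u           ≡⟨ sym (card-complement (λ y → A y ∧ related y u) (λ y → related y v)) ⟩
        card E′ + card (λ y → (A y ∧ related y u) ∧ related y v)
                           ≡⟨ cong (card E′ +_) (Σv-cong λ y → shuffle (A y) (related y u) (related y v)) ⟩
        card E′ + card K   ∎

    bound : card (λ w → near v w ∧ hit (A ∖ v) w) ≤ card A
    bound = begin
      card (λ w → near v w ∧ hit (A ∖ v) w)
        ≤⟨ Σv-mono cover ⟩
      Σv (λ w → 𝟙 (common v u w) + card (λ y → (A ∖ v) y ∧ outside v y u w))
        ≡⟨ Σv-+ (𝟙 ∘ common v u) _ ⟩
      card (common v u) + Σv (λ w → card (λ y → (A ∖ v) y ∧ outside v y u w))
        ≡⟨ cong (card (common v u) +_) (Σv-swap (λ w y → 𝟙 ((A ∖ v) y ∧ outside v y u w))) ⟩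
      card (common v u) + Σv (λ y → Σv (λ w → 𝟙 ((A ∖ v) y ∧ outside v y u w)))
        ≤⟨ +-mono-≤ (card-common≤2 6<n u≢v) (Σv-mono charge) ⟩
      -- The 2 paid for `common v u` restores `v` and `u` to the relatives of `v`, so the total is
      -- `degree v + card E`.
      2 + Σv (λ y → 𝟙 (((P ∖ v) ∖ u) y) + 𝟙 (E y))
        ≡⟨ cong (2 +_) (Σv-+ (𝟙 ∘ ((P ∖ v) ∖ u)) (𝟙 ∘ E)) ⟩
      2 + card ((P ∖ v) ∖ u) + card E
        ≡⟨ cong (_+ card E) (sym card-P) ⟩
      degree v + card E
        ≡⟨ +-comm (degree v) (card E) ⟩
      card E + degree v
        ≤⟨ E≤ ⟩
      card A ∎
      where open ≤-Reasoning

card-near : ∀ {n} → 6 < n → (v : Vertex n) → 2 + n ≤ card (near v)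
card-near 6<n v = injection⇒≤card (near v) (λ k → nb k v) (λ k → nb⇒near v k refl) (λ i j i≢j e → i≢j (nb-injective 6<n i j v e))

-- `hit A` is N[A]. Adding the vertex `v` with fewest relatives enlarges it by at least n + 2 - |A|,
-- which is f(n+2,k) - f(n+2,k-1) for k = |A|.
folded-expansion : ∀ {n} → 6 < n → ∀ a (A : Vertex n → Bool) → card A ≡ suc a → Bound (2 + n) (suc a) (card (hit A))
folded-expansion {n} 6<n a A eq with card-pos A (≤-trans (s≤s z≤n) (≤-reflexive (sym eq)))
... | v₀ , Av₀ with argmin A (degree 6<n A) v₀ Av₀
... | v , Av , minimal = go a eq
  where
  A′ = A ∖ v
  h h′ c : ℕ
  h  = card (hit A)
  h′ = card (hit A′)
  c  = card (λ w → near v w ∧ hit A′ w)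

  near≤ : ∀ w → 𝟙 (near v w) ≤ 𝟙 (hit A w)
  near≤ w = 𝟙-mono (hit-intro {A = A} {v} {w} Av)

  grow : ∀ w → 𝟙 (hit A′ w) + 𝟙 (near v w) ≤ 𝟙 (hit A w) + 𝟙 (near v w ∧ hit A′ w)
  grow w with hit A′ w in h′w | near v w in vw
  ... | false | false = z≤n
  ... | false | true rewrite hit-intro {A = A} {v} {w} Av vw = ≤-refl
  ... | true | b with hit-elim {A = A′} {w} h′w
  ...   | u , A′u , uw rewrite hit-intro {A = A} {u} {w} (proj₁ (∖-elim A v A′u)) uw with b
  ...     | true  = ≤-refl
  ...     | false = ≤-refl

  growth : h′ + (2 + n) ≤ h + c
  growth = begin
    h′ + (2 + n)        ≤⟨ +-monoʳ-≤ h′ (card-near 6<n v) ⟩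
    h′ + card (near v)  ≡⟨ sym (Σv-+ (𝟙 ∘ hit A′) (𝟙 ∘ near v)) ⟩
    _                   ≤⟨ Σv-mono grow ⟩
    _                   ≡⟨ Σv-+ (𝟙 ∘ hit A) _ ⟩
    h + c               ∎
    where open ≤-Reasoning

  go : ∀ a → card A ≡ suc a → Bound (2 + n) (suc a) h
  go zero    eq = ≤-by 0 (*-monoʳ-≤ 2 (≤-trans (card-near 6<n v) (Σv-mono near≤))) (identity n h)
    where
    identity : ∀ n h → 2 * (1 * (2 + n)) + 2 + 2 * h + 0 ≡ 2 * h + 1 * (1 + 1) + 2 * (2 + n)
    identity = solve-∀
  go (suc a) eq = ≤-by 0 (+-mono-≤ (folded-expansion 6<n a A′ (suc-injective (trans (sym (card-∖ A v Av)) eq)))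
      (*-monoʳ-≤ 2 (+-mono-≤ growth (≤-trans (overlap≤ 6<n A v Av minimal) (≤-reflexive eq)))))
      (identity n a h h′ c)
    where
    identity : ∀ n a h h′ c →
      2 * ((2 + a) * (2 + n)) + 2 + (2 * h′ + (1 + a) * (1 + a + 1) + 2 * (h + c + (2 + a))) + 0
      ≡ 2 * h + (2 + a) * (2 + a + 1) + (2 * ((1 + a) * (2 + n)) + 2 + 2 * (h′ + (2 + n) + c))
    identity = solve-∀

hamming-flip : ∀ {n} (u : Vertex n) s → hamming u (updateAt u s not) ≡ 1
hamming-flip (true ∷ u)  zero    = cong suc (hamming-refl u)
hamming-flip (false ∷ u) zero    = cong suc (hamming-refl u)
hamming-flip (true ∷ u)  (suc s) = hamming-flip u s
hamming-flip (false ∷ u) (suc s) = hamming-flip u s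

-- N[A] lies in the union of A and S, and f(n+2,k) - k = f(n+1,k).
folded-boundary : ∀ {n} → 6 < n → (c : Vertex n → Part) → Separates AdjFQ c → 1 ≤ #A c → Bound (1 + n) (#A c) (#S c)
folded-boundary {n} 6<n c sep 1≤a with ≤⇒+ 1≤a
... | a , eq = subst (λ a → Bound (1 + n) a (#S c)) (sym eq)
    (≤-by 0 (+-mono-≤ (folded-expansion 6<n a (isA ∘ c) eq) (*-monoʳ-≤ 2 hit≤)) (identity n a (card (hit (isA ∘ c))) (#S c)))
  where
  identity : ∀ n a h s → 2 * ((1 + a) * (1 + n)) + 2 + (2 * h + (1 + a) * (1 + a + 1) + 2 * (1 + a + s)) + 0
    ≡ 2 * s + (1 + a) * (1 + a + 1) + (2 * ((1 + a) * (2 + n)) + 2 + 2 * h)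
  identity = solve-∀
  isA⇒ : ∀ {p} → isA p ≡ true → p ≡ inA
  isA⇒ {inA} _ = refl
  inside : ∀ {p} → p ≢ inB → 1 ≤ 𝟙 (isA p) + 𝟙 (isS p)
  inside {inA} _  = ≤-refl
  inside {inS} _  = ≤-refl
  inside {inB} ne = ⊥-elim (ne refl)
  not-B : ∀ u k → c u ≡ inA → c (nb k u) ≢ inB
  not-B u zero          e f with () ← trans (sym e) f
  not-B u (suc zero)    e f = sep u (complement u) (inj₂ refl) e f
  not-B u (suc (suc s)) e f = sep u (updateAt u s not) (inj₁ (hamming-flip u s)) e f
  pointwise : ∀ w → 𝟙 (hit (isA ∘ c) w) ≤ 𝟙 (isA (c w)) + 𝟙 (isS (c w))
  pointwise w with hit (isA ∘ c) w in h
  ... | false = z≤n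
  ... | true with hit-elim {A = isA ∘ c} {w} h
  ...   | u , Au , uw with near⇒nb {u = u} uw
  ...     | k , refl = inside (not-B u k (isA⇒ Au))
  hit≤ : card (hit (isA ∘ c)) ≤ 1 + a + #S c
  hit≤ = ≤-trans (Σv-mono pointwise) (≤-reflexive (trans (Σv-+ (𝟙 ∘ isA ∘ c) (𝟙 ∘ isS ∘ c)) (cong (_+ #S c) eq)))

-- Automorphisms of the folded hypercube.

record Aut (n : ℕ) : Set where
  field
    to    : Vertex n → Vertex n
    hom   : ∀ u v → AdjFQ u v → AdjFQ (to u) (to v)
    -- Stands in for bijectivity of `to` and carries all cardinalities over at once.
    Σ-inv : ∀ f → Σv (f ∘ to) ≡ Σv f
open Aut

_⊙_ : ∀ {n} → Aut n → Aut n → Aut n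
to    (φ ⊙ ψ) = to φ ∘ to ψ
hom   (φ ⊙ ψ) u v = hom φ _ _ ∘ hom ψ u v
Σ-inv (φ ⊙ ψ) f = trans (Σ-inv ψ (f ∘ to φ)) (Σ-inv φ f)

hamming-∷ : ∀ {n} b c (u v : Vertex n) → hamming (b ∷ u) (c ∷ v) ≡ 𝟙 (b xor c) + hamming u v
hamming-∷ true  true  u v = refl
hamming-∷ true  false u v = refl
hamming-∷ false true  u v = refl
hamming-∷ false false u v = refl

hamming-insertAt : ∀ {n} (u v : Vertex n) i b c → hamming (insertAt u i b) (insertAt v i c) ≡ hamming (b ∷ u) (c ∷ v)
hamming-insertAt u v zero b c = refl
hamming-insertAt (x ∷ u) (y ∷ v) (suc i) b c
  rewrite hamming-∷ x y (insertAt u i b) (insertAt v i c) | hamming-insertAt u v i b c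
        | hamming-∷ b c u v | hamming-∷ b c (x ∷ u) (y ∷ v) | hamming-∷ x y u v
  = comm-left (𝟙 (x xor y)) (𝟙 (b xor c)) (hamming u v)
  where
  comm-left : ∀ p q r → p + (q + r) ≡ q + (p + r)
  comm-left = solve-∀

-- Moves the first coordinate to position `i`, so halving `c ∘ rotate i` at the head halves `c`
-- along coordinate `i`.
rotate : ∀ {n} → Fin (suc n) → Vertex (suc n) → Vertex (suc n)
rotate i (b ∷ u) = insertAt u i b

Σv-rotate : ∀ {n} (i : Fin (suc n)) f → Σv (f ∘ rotate i) ≡ Σv f
Σv-rotate zero f = refl
Σv-rotate {suc n} (suc i) f =
  trans (+-interchange (Σv (λ u → f (true ∷ insertAt u i true))) _ _ _)
    (cong₂ _+_ (Σv-rotate i (f ∘ (true ∷_))) (Σv-rotate i (f ∘ (false ∷_))))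

rotation : ∀ {n} → Fin (suc n) → Aut (suc n)
to    (rotation i) = rotate i
hom   (rotation i) (b ∷ u) (c ∷ v) (inj₁ h) = inj₁ (trans (hamming-insertAt u v i b c) h)
hom   (rotation i) (b ∷ u) _ (inj₂ refl) = inj₂ (sym (map-insertAt not b u i))
Σ-inv (rotation i) = Σv-rotate i

complement-involutive : ∀ {n} (u : Vertex n) → complement (complement u) ≡ u
complement-involutive []      = refl
complement-involutive (b ∷ u) = cong₂ _∷_ (not-involutive b) (complement-involutive u)

hamming-complement : ∀ {n} (u v : Vertex n) → hamming (complement u) (complement v) ≡ hamming u v
hamming-complement []          []          = refl
hamming-complement (true ∷ u)  (true ∷ v)  = hamming-complement u v
hamming-complement (true ∷ u)  (false ∷ v) = cong suc (hamming-complement u v)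
hamming-complement (false ∷ u) (true ∷ v)  = cong suc (hamming-complement u v)
hamming-complement (false ∷ u) (false ∷ v) = hamming-complement u v

hamming≡0 : ∀ {n} (u v : Vertex n) → hamming u v ≡ 0 → u ≡ v
hamming≡0 []          []          _ = refl
hamming≡0 (true ∷ u)  (true ∷ v)  h = cong (true ∷_) (hamming≡0 u v h)
hamming≡0 (false ∷ u) (false ∷ v) h = cong (false ∷_) (hamming≡0 u v h)

Σv-complement : ∀ {n} (f : Vertex n → ℕ) → Σv (f ∘ complement) ≡ Σv f
Σv-complement {zero}  f = refl
Σv-complement {suc n} f = trans (cong₂ _+_ (Σv-complement (f ∘ (false ∷_))) (Σv-complement (f ∘ (true ∷_))))
  (+-comm (Σv (f ∘ (false ∷_))) _)

-- The linear map exchanging the generators e₁ and 1…1.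
shear : ∀ {n} → Vertex (suc n) → Vertex (suc n)
shear (true ∷ u)  = true ∷ complement u
shear (false ∷ u) = false ∷ u

shearing : ∀ {n} → Aut (suc n)
to    shearing = shear
hom   shearing (true ∷ u)  (true ∷ v)  (inj₁ h) = inj₁ (trans (hamming-complement u v) h)
hom   shearing (true ∷ u)  (false ∷ v) (inj₁ h) rewrite hamming≡0 u v (suc-injective h) =
  inj₂ (cong (false ∷_) (sym (complement-involutive v)))
hom   shearing (false ∷ u) (true ∷ v)  (inj₁ h) rewrite hamming≡0 u v (suc-injective h) = inj₂ refl
hom   shearing (false ∷ u) (false ∷ v) (inj₁ h) = inj₁ h
hom   shearing (true ∷ u)  _ (inj₂ refl) = inj₁ (cong suc (hamming-refl (complement u)))
hom   shearing (false ∷ u) _ (inj₂ refl) = inj₁ (cong suc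
  (trans (cong (hamming u) (complement-involutive u)) (hamming-refl u)))
Σ-inv shearing f = cong (_+ Σv (f ∘ (false ∷_))) (Σv-complement (f ∘ (true ∷_)))

-- Excluding two large sides with a small separator.

-- With N = (1 + m)(2 + m), twice f(m+2,m), the cube has at least 2 N + 16 vertices: the margin
-- behind the later counting contradictions.
pow-large : ∀ {m} → 7 ≤ m → 2 * ((1 + m) * (2 + m)) + 16 ≤ 2 ^ (1 + m)
pow-large 7≤m with ≤⇒+ 7≤m
... | t , refl = go t
  where
  identity : ∀ t p → 2 * ((9 + t) * (10 + t)) + 16 + 2 * p + (2 * (t * t) + 30 * t + 124)
                   ≡ 2 * p + 2 * (2 * ((8 + t) * (9 + t)) + 16)
  identity = solve-∀
  go : ∀ t → 2 * ((8 + t) * (9 + t)) + 16 ≤ 2 ^ (8 + t)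
  go zero    = m≤m+n 160 96
  go (suc t) = subst (λ k → 2 * ((9 + t) * (10 + t)) + 16 ≤ 2 ^ k) (+-suc 8 t)
    (≤-by (2 * (t * t) + 30 * t + 124) (*-monoʳ-≤ 2 (go t)) (identity t (2 ^ (8 + t))))

-- The halves add up to f(m+1,m+1) + (2 + i)(2 + j). For m ≥ 6 the surplus is at least m, which
-- lifts the sum to f(m+2,m); this is why three vertices are demanded on each side.
two-halves : ∀ {m} i j s₀ s₁ → m ≡ 5 + (i + j) → 6 ≤ m → Bound m (3 + i) s₀ → Bound m (3 + j) s₁ →
  (1 + m) * (2 + m) ≤ 2 * (s₁ + s₀)
two-halves i j s₀ s₁ refl 6≤m p q = ≤-by (2 * (i * j)) (+-mono-≤ (+-mono-≤ p q) (*-monoʳ-≤ 2 6≤m)) (identity i j s₀ s₁)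
  where
  identity : ∀ i j s₀ s₁ → (1 + (5 + (i + j))) * (2 + (5 + (i + j)))
      + (2 * s₀ + (3 + i) * (3 + i + 1) + (2 * s₁ + (3 + j) * (3 + j + 1)) + 2 * (5 + (i + j))) + 2 * (i * j)
    ≡ 2 * (s₁ + s₀) + (2 * ((3 + i) * (5 + (i + j))) + 2 + (2 * ((3 + j) * (5 + (i + j))) + 2) + 2 * 6)
  identity = solve-∀

-- A separation in FQ_n, n = m + 1, with |A| beyond the reach of `folded-boundary` and |S| below
-- f(n+1,m), the largest of the claimed bounds.
record Large {m} (c : Vertex (suc m) → Part) : Set where
  field
    sep   : Separates AdjFQ c
    7≤m   : 7 ≤ m
    4+m≤a : 4 + m ≤ #A c
    a≤b   : #A c ≤ #B c
    small : 2 * #S c < (1 + m) * (2 + m)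

Large-∘ : ∀ {m} {c : Vertex (suc m) → Part} → Large c → (φ : Aut (suc m)) → Large (c ∘ to φ)
Large-∘ {m} {c} L φ = record
  { 7≤m    = 7≤m
  ; sep    = λ u v u~v → sep (to φ u) (to φ v) (hom φ u v u~v)
  ; 4+m≤a = ≤-trans 4+m≤a (≤-reflexive (sym (Σ-inv φ (𝟙 ∘ isA ∘ c))))
  ; a≤b    = ≤-trans (≤-reflexive (Σ-inv φ (𝟙 ∘ isA ∘ c))) (≤-trans a≤b (≤-reflexive (sym (Σ-inv φ (𝟙 ∘ isB ∘ c)))))
  ; small  = ≤-trans (s≤s (≤-reflexive (cong (2 *_) (Σ-inv φ (𝟙 ∘ isS ∘ c))))) small
  }
  where open Large L

-- If one half had at most two vertices of B, the other would have at most 2 + s, so |B| ≤ 4 + |S|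
-- and the cube would have at most 8 + 3 |S| vertices.
no-thin-part : ∀ {N p x y s s′} → 2 * N + 16 ≤ p → p ≤ 2 * (y + x) + (s′ + s) → 2 * (s′ + s) < N →
  y ≤ x + s → ¬ x ≤ 2
no-thin-part {N} {p} {x} {y} {s} {s′} N≤p p≤ small y≤ x≤2 = 1+n≰n {0} (≤-by (N + 18 + 4 * s′)
    (+-mono-≤ (*-monoʳ-≤ 2 (≤-trans N≤p p≤)) (+-mono-≤ (*-monoʳ-≤ 4 y≤) (+-mono-≤ (*-monoʳ-≤ 8 x≤2) (*-monoʳ-≤ 3 small))))
    (identity N x y s s′))
  where
  identity : ∀ N x y s s′ →
    1 + (2 * (2 * (y + x) + (s′ + s)) + (4 * (x + s) + (8 * 2 + 3 * N))) + (N + 18 + 4 * s′)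
    ≡ 0 + (2 * (2 * N + 16) + (4 * y + (8 * x + 3 * (1 + 2 * (s′ + s)))))
  identity = solve-∀

no-thin-minority : ∀ {m H N s k} → 2 * N + 16 ≤ 2 * H → H ≤ s + k → 2 * s < N → 2 * m ≤ N → ¬ k < 1 + m
no-thin-minority {m} {H} {N} {s} {k} N≤H H≤ small m≤N k< = 1+n≰n {0} (≤-by 16
    (+-mono-≤ (+-mono-≤ (≤-trans N≤H (*-monoʳ-≤ 2 H≤)) small) (+-mono-≤ (*-monoʳ-≤ 2 k<) m≤N))
    (identity m N s k))
  where
  identity : ∀ m N s k → 1 + (2 * (s + k) + N + (2 * (1 + m) + N)) + 16 ≡ 0 + (2 * N + 16 + (1 + 2 * s) + (2 * (1 + k) + 2 * m))
  identity = solve-∀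

2m≤[1+m][2+m] : ∀ m → 2 * m ≤ (1 + m) * (2 + m)
2m≤[1+m][2+m] m = ≤-by (m * m + m + 2) z≤n (identity m)
  where
  identity : ∀ m → 2 * m + 0 + (m * m + m + 2) ≡ (1 + m) * (2 + m) + 0
  identity = solve-∀

-- With three vertices of A in both halves, each half also has three of B. The minorities can then
-- be lowered to i + j = m + 1 with i, j ≥ 3, hence i, j ≤ m - 2, the range of the cube bound.
head-unbalanced : ∀ {m} {c : Vertex (suc m) → Part} → Large c →
  #A (c ∘ (true ∷_)) ≤ 2 ⊎ #A (c ∘ (false ∷_)) ≤ 2
head-unbalanced {m} {c} L with 3 ≤? #A (c ∘ (true ∷_)) | 3 ≤? #A (c ∘ (false ∷_))
... | no p | _    = inj₁ (≤-pred (≰⇒> p))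
... | yes _ | no p = inj₂ (≤-pred (≰⇒> p))
... | yes 3≤a₁ | yes 3≤a₀ = ⊥-elim absurd
  where
  open Large L
  open Halves c (λ u v h → sep u v (inj₁ h))
  s₀ s₁ k₀ k₁ N : ℕ
  s₀ = #S c₀
  s₁ = #S c₁
  k₀ = #A c₀ ⊓ #B c₀
  k₁ = #A c₁ ⊓ #B c₁
  N = (1 + m) * (2 + m)

  total : 2 ^ (1 + m) ≤ 2 * (#B c₁ + #B c₀) + (s₁ + s₀)
  total = begin
    2 ^ (1 + m)           ≡⟨ sym (#A+#S+#B c) ⟩
    #A c + #S c + #B c    ≤⟨ +-monoˡ-≤ (#B c) (+-monoˡ-≤ (#S c) a≤b) ⟩
    #B c + #S c + #B c    ≡⟨ identity (#B c) (#S c) ⟩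
    2 * #B c + #S c       ∎
    where
    open ≤-Reasoning
    identity : ∀ b s → b + s + b ≡ 2 * b + s
    identity = solve-∀

  3≤b₀ : 3 ≤ #B c₀
  3≤b₀ = ≰⇒> (no-thin-part {x = #B c₀} {#B c₁} {s₀} {s₁} (pow-large 7≤m) total small b₁≤)

  3≤b₁ : 3 ≤ #B c₁
  3≤b₁ = ≰⇒> (no-thin-part {x = #B c₁} {#B c₀} {s₁} {s₀} (pow-large 7≤m)
    (subst (λ x → 2 ^ (1 + m) ≤ x) (cong₂ (λ x y → 2 * x + y) (+-comm (#B c₁) (#B c₀)) (+-comm s₁ s₀)) total)
    (subst (λ x → 2 * x < N) (+-comm s₁ s₀) small) b₀≤)

  rec : ∀ (c : Vertex m → Part) → Separates AdjQ c → ∀ i → 3 ≤ i → 2 + i ≤ m → i ≤ #A c ⊓ #B c → Bound m i (#S c)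
  rec c sep i 3≤i i≤ i≤k = cube-separation-≤ (≤-trans (s≤s z≤n) 3≤i) i≤ c sep (≤⊓ˡ i≤k) (≤⊓ʳ {i} {#A c} i≤k)

  from-split : (∃₂ λ i j → i + j ≡ 1 + m × 3 ≤ i × 3 ≤ j × i ≤ k₀ × j ≤ k₁) → N ≤ 2 * (s₁ + s₀)
  from-split (i , j , eq , 3≤i , 3≤j , i≤ , j≤) with ≤⇒+ 3≤i | ≤⇒+ 3≤j
  ... | i′ , refl | j′ , refl = two-halves i′ j′ s₀ s₁ m≡ (≤-trans (n≤1+n 6) 7≤m)
          (rec c₀ sep₀ (3 + i′) 3≤i (≤-trans (+-monoʳ-≤ 5 (m≤m+n i′ j′)) (≤-reflexive (sym m≡))) i≤)
          (rec c₁ sep₁ (3 + j′) 3≤j (≤-trans (+-monoʳ-≤ 5 (m≤n+m j′ i′)) (≤-reflexive (sym m≡))) j≤)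
    where
    identity : ∀ i j → 3 + i + (3 + j) ≡ 6 + (i + j)
    identity = solve-∀
    m≡ : m ≡ 5 + (i′ + j′)
    m≡ = suc-injective (trans (sym eq) (identity i′ j′))

  balanced : 1 + m ≤ k₀ + k₁ → N ≤ 2 * (s₁ + s₀)
  balanced q = from-split (split-≤ 3 (1 + m) {k₀} {k₁} (⊓-glb 3≤a₀ 3≤b₀) (⊓-glb 3≤a₁ 3≤b₁)
    (≤-trans (n≤1+n 6) (≤-trans 7≤m (n≤1+n m))) q)

  absurd : ⊥
  absurd with 1 + m ≤? k₀ + k₁
  ... | yes q = <⇒≱ small (balanced q)
  ... | no q with minority-sum {#A c₀} {#B c₀} {s₀} {#A c₁} {#B c₁} {s₁} {2 ^ m} {1 + m}
                    (#A+#S+#B c₀) (#A+#S+#B c₁) a₀≤ a₁≤ b₀≤ b₁≤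
                    (≤-trans (m≤n+m _ 3) 4+m≤a) (≤-trans (m≤n+m _ 3) (≤-trans 4+m≤a a≤b))
  ...   | inj₁ q′ = q q′
  ...   | inj₂ h  = no-thin-minority {s = s₁ + s₀} {k₀ + k₁} (pow-large 7≤m) h small (2m≤[1+m][2+m] m) (≰⇒> q)

-- `ℓ` is the function on vertices that `φ` pulls back to the first coordinate.
Aut-unbalanced : ∀ {m} {c : Vertex (suc m) → Part} → Large c → (φ : Aut (suc m)) (ℓ : Vertex (suc m) → Bool) →
  (∀ b u → ℓ (to φ (b ∷ u)) ≡ b) →
  card (λ z → isA (c z) ∧ ℓ z) ≤ 2 ⊎ card (λ z → isA (c z) ∧ not (ℓ z)) ≤ 2
Aut-unbalanced {m} {c} L φ ℓ ℓ-head with head-unbalanced (Large-∘ L φ)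
... | inj₁ p = inj₁ (≤-trans (≤-reflexive (trans (sym (Σ-inv φ (λ z → 𝟙 (isA (c z) ∧ ℓ z))))
        (trans (cong₂ _+_ (Σv-cong λ u → keep true u (ℓ-head true u)) (Σv-cong λ u → drop false u (ℓ-head false u)))
          (trans (cong (#A (c ∘ to φ ∘ (true ∷_)) +_) (Σv-0 m)) (+-identityʳ _))))) p)
  where
  keep : ∀ b u → ℓ (to φ (b ∷ u)) ≡ true → 𝟙 (isA (c (to φ (b ∷ u))) ∧ ℓ (to φ (b ∷ u))) ≡ 𝟙 (isA (c (to φ (b ∷ u))))
  keep b u e rewrite e = cong 𝟙 (∧-identityʳ _)
  drop : ∀ b u → ℓ (to φ (b ∷ u)) ≡ false → 𝟙 (isA (c (to φ (b ∷ u))) ∧ ℓ (to φ (b ∷ u))) ≡ 0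
  drop b u e rewrite e = cong 𝟙 (∧-zeroʳ _)
... | inj₂ p = inj₂ (≤-trans (≤-reflexive (trans (sym (Σ-inv φ (λ z → 𝟙 (isA (c z) ∧ not (ℓ z)))))
        (cong₂ _+_ (trans (Σv-cong λ u → drop true u (ℓ-head true u)) (Σv-0 m)) (Σv-cong λ u → keep false u (ℓ-head false u))))) p)
  where
  keep : ∀ b u → ℓ (to φ (b ∷ u)) ≡ false → 𝟙 (isA (c (to φ (b ∷ u))) ∧ not (ℓ (to φ (b ∷ u)))) ≡ 𝟙 (isA (c (to φ (b ∷ u))))
  keep b u e rewrite e = cong 𝟙 (∧-identityʳ _)
  drop : ∀ b u → ℓ (to φ (b ∷ u)) ≡ true → 𝟙 (isA (c (to φ (b ∷ u))) ∧ not (ℓ (to φ (b ∷ u)))) ≡ 0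
  drop b u e rewrite e = cong 𝟙 (∧-zeroʳ _)

union-bound : ∀ {n} k (P : Vertex n → Bool) z₀ (q : Fin k → Vertex n → Bool) →
  (∀ z → P z ≡ true → z₀ ≡ z ⊎ ∃ λ j → q j z ≡ true) →
  (∀ j → card (λ z → P z ∧ q j z) ≤ 1) → card P ≤ 1 + k
union-bound zero P z₀ q covers q≤1 = ≤-trans (Σv-mono λ z → 𝟙-mono (at-z₀ z)) (≤-reflexive (Σv-𝟙== z₀))
  where
  at-z₀ : ∀ z → P z ≡ true → (z₀ == z) ≡ true
  at-z₀ z Pz with covers z Pz
  ... | inj₁ refl = ==-refl z
union-bound (suc k) P z₀ q covers q≤1 = begin
  card P                                                              ≡⟨ sym (card-complement P (q zero)) ⟩
  card (λ z → P z ∧ not (q zero z)) + card (λ z → P z ∧ q zero z)     ≤⟨ +-mono-≤ (union-bound k _ z₀ (q ∘ suc) covers′ q≤1′) (q≤1 zero) ⟩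
  1 + k + 1                                                           ≡⟨ +-comm (1 + k) 1 ⟩
  2 + k                                                               ∎
  where
  open ≤-Reasoning
  covers′ : ∀ z → P z ∧ not (q zero z) ≡ true → z₀ ≡ z ⊎ ∃ λ j → q (suc j) z ≡ true
  covers′ z e with covers z (proj₁ (∧-true e))
  ... | inj₁ z₀≡z       = inj₁ z₀≡z
  ... | inj₂ (suc j , f) = inj₂ (j , f)
  ... | inj₂ (zero , f) with proj₂ (∧-true {P z} e)
  ...   | g rewrite f with () ← g
  weaken : ∀ a b c → 𝟙 ((a ∧ b) ∧ c) ≤ 𝟙 (a ∧ c)
  weaken false b     c = z≤n
  weaken true  false c = z≤n
  weaken true  true  c = ≤-refl
  q≤1′ : ∀ j → card (λ z → (P z ∧ not (q zero z)) ∧ q (suc j) z) ≤ 1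
  q≤1′ j = ≤-trans (Σv-mono λ z → weaken (P z) _ (q (suc j) z)) (q≤1 (suc j))

-- Within `A`, the symmetric difference of `x` and `y` together with `y` counts the points of `y`
-- outside `x` twice and those of `x` once.
card-crossing : ∀ {n} (A x y : Vertex n → Bool) →
  2 * card (λ z → (A z ∧ not (x z)) ∧ y z) + card (λ z → A z ∧ x z)
  ≤ card (λ z → A z ∧ (x z xor y z)) + card (λ z → A z ∧ y z)
card-crossing A x y = begin
  2 * card (λ z → (A z ∧ not (x z)) ∧ y z) + card (λ z → A z ∧ x z)
    ≡⟨ cong (_+ card (λ z → A z ∧ x z)) (sym (Σv-*ˡ 2 (λ z → 𝟙 ((A z ∧ not (x z)) ∧ y z)))) ⟩
  Σv (λ z → 2 * 𝟙 ((A z ∧ not (x z)) ∧ y z)) + card (λ z → A z ∧ x z)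
    ≡⟨ sym (Σv-+ (λ z → 2 * 𝟙 ((A z ∧ not (x z)) ∧ y z)) _) ⟩
  Σv (λ z → 2 * 𝟙 ((A z ∧ not (x z)) ∧ y z) + 𝟙 (A z ∧ x z))
    ≤⟨ Σv-mono (λ z → lem (A z) (x z) (y z)) ⟩
  Σv (λ z → 𝟙 (A z ∧ (x z xor y z)) + 𝟙 (A z ∧ y z))
    ≡⟨ Σv-+ (λ z → 𝟙 (A z ∧ (x z xor y z))) _ ⟩
  card (λ z → A z ∧ (x z xor y z)) + card (λ z → A z ∧ y z) ∎
  where
  open ≤-Reasoning
  lem : ∀ a b c → 2 * 𝟙 ((a ∧ not b) ∧ c) + 𝟙 (a ∧ b) ≤ 𝟙 (a ∧ (b xor c)) + 𝟙 (a ∧ c)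
  lem false b     c     = z≤n
  lem true  false false = z≤n
  lem true  false true  = ≤-refl
  lem true  true  false = ≤-refl
  lem true  true  true  = ≤-refl

card-parallel : ∀ {n} (A x y : Vertex n → Bool) →
  card A ≤ card (λ z → A z ∧ not (x z xor y z)) + (card (λ z → A z ∧ x z) + card (λ z → A z ∧ y z))
card-parallel A x y = begin
  card A
    ≤⟨ Σv-mono (λ z → lem (A z) (x z) (y z)) ⟩
  Σv (λ z → 𝟙 (A z ∧ not (x z xor y z)) + (𝟙 (A z ∧ x z) + 𝟙 (A z ∧ y z)))
    ≡⟨ Σv-+ (λ z → 𝟙 (A z ∧ not (x z xor y z))) _ ⟩
  card (λ z → A z ∧ not (x z xor y z)) + Σv (λ z → 𝟙 (A z ∧ x z) + 𝟙 (A z ∧ y z))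
    ≡⟨ cong (card (λ z → A z ∧ not (x z xor y z)) +_) (Σv-+ (λ z → 𝟙 (A z ∧ x z)) _) ⟩
  card (λ z → A z ∧ not (x z xor y z)) + (card (λ z → A z ∧ x z) + card (λ z → A z ∧ y z)) ∎
  where
  open ≤-Reasoning
  lem : ∀ a b c → 𝟙 a ≤ 𝟙 (a ∧ not (b xor c)) + (𝟙 (a ∧ b) + 𝟙 (a ∧ c))
  lem false b     c     = z≤n
  lem true  false false = s≤s z≤n
  lem true  false true  = s≤s z≤n
  lem true  true  false = s≤s z≤n
  lem true  true  true  = s≤s z≤n

-- All but at most two elements of A agree with `centre` in any given coordinate, and sums of two
-- coordinates are as unbalanced. If some coordinate has two deviators, every other coordinate has
-- at most one outside them; if none has, each has at most one. Either way |A| ≤ m + 3.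
not-Large : ∀ {m} {c : Vertex (suc m) → Part} → Large c → ⊥
not-Large {m} {c} L = absurd
  where
  open Large L
  n = suc m
  A : Vertex n → Bool
  A = isA ∘ c

  bit-unbalanced : ∀ i → card (λ z → A z ∧ lookup z i) ≤ 2 ⊎ card (λ z → A z ∧ not (lookup z i)) ≤ 2
  bit-unbalanced i = Aut-unbalanced L (rotation i) (λ z → lookup z i) (λ b u → insertAt-lookup u i b)

  majority : ∀ i → ∃ λ b → card (λ z → A z ∧ (lookup z i xor b)) ≤ 2
  majority i with bit-unbalanced i
  ... | inj₁ p = false , ≤-trans (≤-reflexive (Σv-cong λ z → cong (λ b → 𝟙 (A z ∧ b)) (xor-identityʳ (lookup z i)))) p
  ... | inj₂ p = true , ≤-trans (≤-reflexive (Σv-cong λ z → cong (λ b → 𝟙 (A z ∧ b)) (xor-comm (lookup z i) true))) p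

  τ : Fin n → Bool
  τ i = proj₁ (majority i)

  deviates : Fin n → Vertex n → Bool
  deviates i z = lookup z i xor τ i

  centre : Vertex n
  centre = tabulate τ

  deviation : ∀ z → centre ≡ z ⊎ ∃ λ i → deviates i z ≡ true
  deviation z with any? (λ i → deviates i z Data.Bool.≟ true)
  ... | yes p = inj₂ p
  ... | no none = inj₁ (sym (lookup-ext λ i → trans (same (lookup z i) (τ i) (λ e → none (i , e))) (sym (lookup∘tabulate τ i))))
    where
    same : ∀ a b → ¬ (a xor b ≡ true) → a ≡ b
    same false false _ = refl
    same true  true  _ = refl
    same false true  f = ⊥-elim (f refl)
    same true  false f = ⊥-elim (f refl)

  pair : Fin n → Fin m → Vertex n → Bool
  pair i j z = lookup z i xor lookup z (punchIn i j)

  -- `rotate (suc j)` moves `b` to position `j` of the tail, `shear` adds the new head to it, and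
  -- `rotate i` moves that head to coordinate `i`.
  pair-head : ∀ i j b u → pair i j (rotate i (shear (rotate (suc j) (b ∷ u)))) ≡ b
  pair-head i j b (false ∷ u)
    rewrite insertAt-lookup (insertAt u j b) i false | insertAt-punchIn (insertAt u j b) i false j = insertAt-lookup u j b
  pair-head i j b (true ∷ u)
    rewrite insertAt-lookup (complement (insertAt u j b)) i true | insertAt-punchIn (complement (insertAt u j b)) i true j
          | lookup-map j not (insertAt u j b) | insertAt-lookup u j b = not-involutive b

  pair-unbalanced : ∀ i j → card (λ z → A z ∧ pair i j z) ≤ 2 ⊎ card (λ z → A z ∧ not (pair i j z)) ≤ 2
  pair-unbalanced i j = Aut-unbalanced L (rotation i ⊙ (shearing ⊙ rotation (suc j))) (pair i j) (pair-head i j)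

  -- Passing from bits to deviations adds the constant τ_i + τ_k, which at most exchanges the two
  -- alternatives.
  deviates-unbalanced : ∀ i j → let k = punchIn i j in
    card (λ z → A z ∧ (deviates i z xor deviates k z)) ≤ 2 ⊎ card (λ z → A z ∧ not (deviates i z xor deviates k z)) ≤ 2
  deviates-unbalanced i j with τ i xor τ k in e | pair-unbalanced i j
    where k = punchIn i j
  ... | false | inj₁ p = inj₁ (≤-trans (≤-reflexive (Σv-cong λ z → cong (λ b → 𝟙 (A z ∧ b)) (lem z))) p)
    where
    lem : ∀ z → deviates i z xor deviates (punchIn i j) z ≡ pair i j z
    lem z = trans (xor-interchange (lookup z i) (τ i) _ _) (trans (cong (pair i j z xor_) e) (xor-identityʳ _))
  ... | false | inj₂ p = inj₂ (≤-trans (≤-reflexive (Σv-cong λ z → cong (λ b → 𝟙 (A z ∧ not b)) (lem z))) p)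
    where
    lem : ∀ z → deviates i z xor deviates (punchIn i j) z ≡ pair i j z
    lem z = trans (xor-interchange (lookup z i) (τ i) _ _) (trans (cong (pair i j z xor_) e) (xor-identityʳ _))
  ... | true | inj₁ p = inj₂ (≤-trans (≤-reflexive (Σv-cong λ z → cong (λ b → 𝟙 (A z ∧ b)) (lem z))) p)
    where
    lem : ∀ z → not (deviates i z xor deviates (punchIn i j) z) ≡ pair i j z
    lem z = trans (cong not (trans (xor-interchange (lookup z i) (τ i) _ _) (trans (cong (pair i j z xor_) e) (xor-comm _ true))))
      (not-involutive _)
  ... | true | inj₂ p = inj₁ (≤-trans (≤-reflexive (Σv-cong λ z → cong (λ b → 𝟙 (A z ∧ b)) (lem z))) p)
    where
    lem : ∀ z → deviates i z xor deviates (punchIn i j) z ≡ not (pair i j z)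
    lem z = trans (xor-interchange (lookup z i) (τ i) _ _) (trans (cong (pair i j z xor_) e) (xor-comm _ true))

  deviators≤2 : ∀ i → card (λ z → A z ∧ deviates i z) ≤ 2
  deviators≤2 i = proj₂ (majority i)

  module Twice (i : Fin n) (twice : 2 ≤ card (λ z → A z ∧ deviates i z)) where
    rest : Vertex n → Bool
    rest z = A z ∧ not (deviates i z)

    module _ (j : Fin m) where
      private
        k = punchIn i j
        x y : Vertex n → Bool
        x = deviates i
        y = deviates k

      -- If the two deviations differ at most twice, `card-crossing` leaves room for one vertex. If
      -- they agree at most twice, |A| ≤ 2 + 2 + 2, contrary to |A| ≥ 4 + m.
      single : card (λ z → rest z ∧ y z) ≤ 1
      single with deviates-unbalanced i j
      ... | inj₁ p = *-cancelˡ-≤ 2 (+-cancelʳ-≤ 2 _ _ (≤-trans (+-monoʳ-≤ (2 * card (λ z → rest z ∧ y z)) twice)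
                       (≤-trans (card-crossing A x y) (+-mono-≤ p (deviators≤2 k)))))
      ... | inj₂ p = ⊥-elim (<⇒≱ {6} {11} (m≤m+n 7 4) (≤-trans (+-monoʳ-≤ 4 7≤m) (≤-trans 4+m≤a
                       (≤-trans (card-parallel A x y) (+-mono-≤ p (+-mono-≤ (deviators≤2 i) (deviators≤2 k)))))))

    covers : ∀ z → rest z ≡ true → centre ≡ z ⊎ ∃ λ j → deviates (punchIn i j) z ≡ true
    covers z Rz with deviation z
    ... | inj₁ e = inj₁ e
    ... | inj₂ (k , dk) with i Finₚ.≟ k
    ...   | no i≢k = inj₂ (punchOut i≢k , trans (cong (λ k → deviates k z) (punchIn-punchOut i≢k)) dk)
    ...   | yes refl with proj₂ (∧-true {A z} Rz)
    ...     | g rewrite dk with () ← g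

    few : #A c ≤ 3 + m
    few = begin
      #A c                                        ≡⟨ sym (card-complement A (deviates i)) ⟩
      card rest + card (λ z → A z ∧ deviates i z) ≤⟨ +-mono-≤ (union-bound m rest centre (λ j → deviates (punchIn i j)) covers single) (deviators≤2 i) ⟩
      1 + m + 2                             ≡⟨ +-comm (1 + m) 2 ⟩
      3 + m                                      ∎
      where open ≤-Reasoning

  absurd : ⊥
  absurd with any? (λ i → 2 ≤? card (λ z → A z ∧ deviates i z))
  ... | yes (i , twice) = <⇒≱ 4+m≤a (Twice.few i twice)
  ... | no none = <⇒≱ (≤-trans (n≤1+n _) 4+m≤a) (union-bound n A centre deviates (λ z _ → deviation z)
                    (λ i → ≤-pred (≰⇒> λ p → none (i , p))))

-- Separation in the folded hypercube.

AdjFQ-sym : ∀ {n} (u v : Vertex n) → AdjFQ u v → AdjFQ v u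
AdjFQ-sym u v (inj₁ h)    = inj₁ (AdjQ-sym u v h)
AdjFQ-sym u v (inj₂ refl) = inj₂ (sym (complement-involutive u))

-- `3 + m` is the last |A| for which the symmetry of f(m+2,·) reaches every g ≤ m. Beyond it, |S|
-- attains f(m+2,m) by `not-Large`.
folded-separation-≤ : ∀ {m g} → 7 ≤ m → 1 ≤ g → g ≤ m → (c : Vertex (1 + m) → Part) → Separates AdjFQ c →
  g ≤ #A c → #A c ≤ #B c → Bound (2 + m) g (#S c)
folded-separation-≤ {m} {g} 7≤m 1≤g g≤m c sep g≤a a≤b with #A c ≤? 3 + m | (1 + m) * (2 + m) ≤? 2 * #S c
... | yes a≤ | _ = Bound-anti (2 + m) (#A c) g (#S c) g≤a
        (≤-trans (+-monoˡ-≤ 1 (+-mono-≤ a≤ g≤m)) (≤-reflexive (identity m)))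
        (folded-boundary (≤-trans 7≤m (n≤1+n m)) c sep (≤-trans 1≤g g≤a))
  where
  identity : ∀ m → 3 + m + m + 1 ≡ 2 * (2 + m)
  identity = solve-∀
... | no _  | yes p = top-Bound m g (#S c) g≤m (≤-trans (≤-reflexive (*-comm (2 + m) (1 + m))) p)
... | no a> | no p  = ⊥-elim (not-Large {c = c} record
        { 7≤m = 7≤m ; sep = sep ; 4+m≤a = ≰⇒> a> ; a≤b = a≤b ; small = ≰⇒> p })

folded-separation : ∀ {m g} → 7 ≤ m → 1 ≤ g → g ≤ m → (c : Vertex (1 + m) → Part) → Separates AdjFQ c →
  g ≤ #A c → g ≤ #B c → Bound (2 + m) g (#S c)
folded-separation {m} {g} 7≤m 1≤g g≤m c sep g≤a g≤b with ≤-total (#A c) (#B c)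
... | inj₁ a≤b = folded-separation-≤ 7≤m 1≤g g≤m c sep g≤a a≤b
... | inj₂ b≤a = Bound-swap {2 + m} {g} {c = c} (folded-separation-≤ 7≤m 1≤g g≤m (swap ∘ c)
        (Separates-swap {_~_ = AdjFQ} AdjFQ-sym sep)
        (≤-trans g≤b (≤-reflexive (sym (#A-swap c))))
        (≤-trans (≤-reflexive (#A-swap c)) (≤-trans b≤a (≤-reflexive (sym (#B-swap c))))))

-- From component cuts to separating colourings.

colour : ∀ {n} → VertexSet n → (Vertex n → Bool) → Vertex n → Part
colour S A v = if S v then inS else if A v then inA else inB

Closed : ∀ {n} → VertexSet n → (Vertex n → Bool) → Set
Closed S A = ∀ u v → A u ≡ true → AdjFQ u v → S v ≡ false → A v ≡ true

colour-A : ∀ {n} (S : VertexSet n) A {v} → colour S A v ≡ inA → A v ≡ true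
colour-A S A {v} e with S v | A v
... | false | true = refl

colour-B : ∀ {n} (S : VertexSet n) A {v} → colour S A v ≡ inB → S v ≡ false × A v ≡ false
colour-B S A {v} e with S v | A v
... | false | false = refl , refl

colour-separates : ∀ {n} (S : VertexSet n) A → Closed S A → Separates AdjFQ (colour S A)
colour-separates S A closed u v u~v cu cv with colour-B S A cv
... | Sv , Av with () ← trans (sym (closed u v (colour-A S A cu) u~v Sv)) Av

#S-colour : ∀ {n} (S : VertexSet n) A → #S (colour S A) ≡ card S
#S-colour S A = Σv-cong λ v → lem (S v) (A v)
  where
  lem : ∀ s a → 𝟙 (isS (if s then inS else if a then inA else inB)) ≡ 𝟙 s
  lem true  a     = refl
  lem false true  = refl
  lem false false = refl

#A-colour≤ : ∀ {n} (S : VertexSet n) A → #A (colour S A) ≤ card A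
#A-colour≤ S A = Σv-mono λ v → lem (S v) (A v)
  where
  lem : ∀ s a → 𝟙 (isA (if s then inS else if a then inA else inB)) ≤ 𝟙 a
  lem true  a     = z≤n
  lem false true  = ≤-refl
  lem false false = ≤-refl

isA-colour : ∀ {n} (S : VertexSet n) A {v} → S v ≡ false → A v ≡ true → isA (colour S A v) ≡ true
isA-colour S A Sv Av rewrite Sv | Av = refl

card≤#A-colour : ∀ {n} (S : VertexSet n) A → (∀ v → A v ≡ true → S v ≡ false) → card A ≤ #A (colour S A)
card≤#A-colour S A avoids = Σv-mono λ v → 𝟙-mono λ Av → isA-colour S A (avoids v Av) Av

isB-colour : ∀ {n} (S : VertexSet n) A {v} → S v ≡ false → A v ≡ false → isB (colour S A v) ≡ true
isB-colour S A Sv Av rewrite Sv | Av = refl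

anyF : ∀ {k} → (Fin k → Bool) → Bool
anyF {zero}  q = false
anyF {suc k} q = q zero ∨ anyF (q ∘ suc)

anyF-intro : ∀ {k} (q : Fin k → Bool) i → q i ≡ true → anyF q ≡ true
anyF-intro q zero    e rewrite e = refl
anyF-intro q (suc i) e rewrite anyF-intro (q ∘ suc) i e = ∨-zeroʳ (q zero)

anyF-elim : ∀ {k} (q : Fin k → Bool) → anyF q ≡ true → ∃ λ i → q i ≡ true
anyF-elim {suc k} q e with q zero in q₀
... | true  = zero , q₀
... | false = let i , f = anyF-elim (q ∘ suc) e in suc i , f

card-anyF : ∀ {n} k b (C : Fin k → Vertex n → Bool) → (∀ i → card (C i) ≤ b) →
  card (λ v → anyF (λ i → C i v)) ≤ k * b
card-anyF {n} zero b C C≤ = ≤-reflexive (Σv-0 n)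
card-anyF (suc k) b C C≤ = begin
  card (λ v → C zero v ∨ anyF (λ i → C (suc i) v))            ≤⟨ Σv-mono (λ v → lem (C zero v) _) ⟩
  Σv (λ v → 𝟙 (C zero v) + 𝟙 (anyF (λ i → C (suc i) v)))      ≡⟨ Σv-+ (𝟙 ∘ C zero) _ ⟩
  card (C zero) + card (λ v → anyF (λ i → C (suc i) v))       ≤⟨ +-mono-≤ (C≤ zero) (card-anyF k b (C ∘ suc) (C≤ ∘ suc)) ⟩
  b + k * b                                                   ∎
  where
  open ≤-Reasoning
  lem : ∀ a c → 𝟙 (a ∨ c) ≤ 𝟙 a + 𝟙 c
  lem false c = ≤-refl
  lem true  c = s≤s z≤n

Reach-avoids : ∀ {n} {S : VertexSet n} {u v} → Reach S u v → S v ≡ false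
Reach-avoids (here e)     = e
Reach-avoids (step _ _ e) = e

-- At most g components with at most g vertices each, a cut below the bound, and g further vertices
-- do not fill the cube.
no-room : ∀ {m g s} → g ≤ m → 2 * ((1 + m) * (2 + m)) + 16 ≤ g * g + s + g →
  ¬ 2 * s + g * (g + 1) < 2 * (g * (2 + m)) + 2
no-room {m} {g} {s} g≤m total small = 1+n≰n {0} (≤-by (m * m + 7 * m + 38)
    (+-mono-≤ (+-mono-≤ (*-monoʳ-≤ 2 total) small)
      (+-mono-≤ (*-mono-≤ g≤m (+-monoˡ-≤ 1 g≤m)) (*-monoʳ-≤ 2 (*-monoˡ-≤ (2 + m) g≤m))))
    (identity m g s))
  where
  identity : ∀ m g s → 1 + (2 * (g * g + s + g) + (2 * (g * (2 + m)) + 2) + (m * (m + 1) + 2 * (m * (2 + m)))) + (m * m + 7 * m + 38)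
    ≡ 0 + (2 * (2 * ((1 + m) * (2 + m)) + 16) + (1 + (2 * s + g * (g + 1))) + (g * (g + 1) + 2 * (g * (2 + m))))
  identity = solve-∀

module _ {m g : ℕ} (7≤m : 7 ≤ m) (1≤g : 1 ≤ g) (g≤m : g ≤ m) (S : VertexSet (1 + m))
         (x : Fin (suc g) → Vertex (1 + m)) (Sx : ∀ i → S (x i) ≡ false)
         (apart : ∀ i j → i ≢ j → ¬ Reach S (x i) (x j))
         (reach? : ∀ i v → Dec (Reach S (x i) v)) where
  private
    C : Fin (suc g) → Vertex (1 + m) → Bool
    C i v = does (reach? i v)

    x∈C : ∀ i → C i (x i) ≡ true
    x∈C i = dec-true (reach? i (x i)) (here (Sx i))

    x∉C : ∀ i j → i ≢ j → C i (x j) ≡ false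
    x∉C i j i≢j = dec-false (reach? i (x j)) (apart i j i≢j)

    C-closed : ∀ i → Closed S (C i)
    C-closed i u v Cu u~v Sv = dec-true (reach? i v) (step (does⇒ (reach? i u) Cu) u~v Sv)

    x-injective : ∀ i j → i ≢ j → x i ≢ x j
    x-injective i j i≢j e = apart i j i≢j (subst (Reach S (x i)) e (here (Sx i)))

    from-colour : ∀ A → Closed S A → g ≤ #A (colour S A) → g ≤ #B (colour S A) → Bound (2 + m) g (card S)
    from-colour A closed g≤a g≤b = subst (Bound (2 + m) g) (#S-colour S A)
      (folded-separation 7≤m 1≤g g≤m (colour S A) (colour-separates S A closed) g≤a g≤b)

    -- A component with g vertices serves as A by itself; the representatives of the other g
    -- components lie in B.
    large-component : ∀ i → g ≤ card (C i) → Bound (2 + m) g (card S)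
    large-component i g≤C = from-colour (C i) (C-closed i)
      (≤-trans g≤C (card≤#A-colour S (C i) λ v Cv → Reach-avoids (does⇒ (reach? i v) Cv)))
      (injection⇒≤card (isB ∘ colour S (C i)) (x ∘ punchIn i)
        (λ j → isB-colour S (C i) (Sx _) (x∉C i (punchIn i j) (punchInᵢ≢i i j ∘ sym)))
        (λ j k j≢k → x-injective _ _ (j≢k ∘ punchIn-injective i j k)))

    -- A is the union of the components of all representatives but the first, and contains g of
    -- them. If S violates the bound, `no-room` leaves at least g vertices for B.
    small-components : (∀ i → card (C i) ≤ g) → Bound (2 + m) g (card S)
    small-components C≤ with 2 * (g * (2 + m)) + 2 ≤? 2 * card S + g * (g + 1)
    ... | yes p = p
    ... | no ¬p = from-colour U U-closed g≤a g≤b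
      where
      U : Vertex (1 + m) → Bool
      U v = anyF (λ i → C (suc i) v)

      U-closed : Closed S U
      U-closed u v Uu u~v Sv with anyF-elim (λ i → C (suc i) u) Uu
      ... | i , Cu = anyF-intro (λ i → C (suc i) v) i (C-closed (suc i) u v Cu u~v Sv)

      g≤a : g ≤ #A (colour S U)
      g≤a = injection⇒≤card (isA ∘ colour S U) (x ∘ suc)
        (λ i → isA-colour S U (Sx (suc i)) (anyF-intro (λ j → C (suc j) (x (suc i))) i (x∈C (suc i))))
        (λ i j i≢j → x-injective _ _ (i≢j ∘ Finₚ.suc-injective))

      g≤b : g ≤ #B (colour S U)
      g≤b with g ≤? #B (colour S U)
      ... | yes q = q
      ... | no q  = ⊥-elim (no-room g≤m (begin
        2 * ((1 + m) * (2 + m)) + 16 ≤⟨ pow-large 7≤m ⟩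
        2 ^ (1 + m)                  ≡⟨ sym (#A+#S+#B (colour S U)) ⟩
        #A (colour S U) + #S (colour S U) + #B (colour S U)
          ≤⟨ +-mono-≤ (+-mono-≤ (≤-trans (#A-colour≤ S U) (card-anyF g g (C ∘ suc) (C≤ ∘ suc))) (≤-reflexive (#S-colour S U)))
                      (<⇒≤ (≰⇒> q)) ⟩
        g * g + card S + g           ∎) (≰⇒> ¬p))
        where open ≤-Reasoning

  component-cut-bound : Bound (2 + m) g (card S)
  component-cut-bound with any? (λ i → g ≤? card (C i))
  ... | yes (i , p) = large-component i p
  ... | no none     = small-components λ i → <⇒≤ (≰⇒> λ p → none (i , p))

-- Over finitely many vertices, double negation commutes with the universal quantifier.
¬¬-Dec-Vertex : ∀ {n} (P : Vertex n → Set) → ¬ ¬ (∀ v → Dec (P v))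
¬¬-Dec-Vertex {zero}  P k = k λ { [] → no λ p → k λ { [] → yes p } }
¬¬-Dec-Vertex {suc n} P k =
  ¬¬-Dec-Vertex (P ∘ (true ∷_)) λ d₁ → ¬¬-Dec-Vertex (P ∘ (false ∷_)) λ d₀ →
  k λ { (true ∷ v) → d₁ v ; (false ∷ v) → d₀ v }

¬¬-Π-Fin : ∀ {k} (P : Fin k → Set) → (∀ i → ¬ ¬ P i) → ¬ ¬ (∀ i → P i)
¬¬-Π-Fin {zero}  P p k = k λ ()
¬¬-Π-Fin {suc m} P p k = p zero λ p₀ → ¬¬-Π-Fin (P ∘ suc) (p ∘ suc) λ ps →
  k λ { zero → p₀ ; (suc i) → ps i }

-- Reachability is only ¬¬-decided here, which suffices because the conclusion is decidable.
cut-lower-bound : ∀ {m g} → 7 ≤ m → 1 ≤ g → g ≤ m → (S : VertexSet (1 + m)) → IsComponentCut (suc g) S → Bound (2 + m) g (card S)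
cut-lower-bound {m} {g} 7≤m 1≤g g≤m S (x , Sx , apart) with 2 * (g * (2 + m)) + 2 ≤? 2 * card S + g * (g + 1)
... | yes p = p
... | no ¬p = ⊥-elim (¬¬-Π-Fin (λ i → ∀ v → Dec (Reach S (x i) v)) (λ i → ¬¬-Dec-Vertex (Reach S (x i)))
                λ reach? → ¬p (component-cut-bound 7≤m 1≤g g≤m S x Sx apart reach?))

-- An optimal cut: the neighbourhood of g neighbours of the zero vertex.

zeros : ∀ {n} → Vertex n → Bool
zeros []          = true
zeros (true ∷ u)  = false
zeros (false ∷ u) = zeros u

ones : ∀ {n} → Vertex n → Bool
ones []          = true
ones (true ∷ u)  = ones u
ones (false ∷ u) = false

weight1 : ∀ {n} → Vertex n → Bool
weight1 []          = false
weight1 (true ∷ u)  = zeros u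
weight1 (false ∷ u) = weight1 u

-- Weight two, with at least one of the ones among the first g coordinates.
weight2 : ∀ {n} → ℕ → Vertex n → Bool
weight2 zero    u           = false
weight2 (suc g) []          = false
weight2 (suc g) (true ∷ u)  = weight1 u
weight2 (suc g) (false ∷ u) = weight2 g u

-- Exactly one zero, situated among the first g coordinates.
coweight1 : ∀ {n} → ℕ → Vertex n → Bool
coweight1 zero    u           = false
coweight1 (suc g) []          = false
coweight1 (suc g) (true ∷ u)  = coweight1 g u
coweight1 (suc g) (false ∷ u) = ones u

-- The neighbours of e_i are the origin, the sums e_i + e_j, and the complement of e_i.
cut : ∀ {n} → ℕ → VertexSet n
cut g v = zeros v ∨ (weight2 g v ∨ coweight1 g v)

card-zeros : ∀ n → card (zeros {n}) ≡ 1
card-zeros zero = refl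
card-zeros (suc n) rewrite Σv-0 n = card-zeros n

card-ones : ∀ n → card (ones {n}) ≡ 1
card-ones zero = refl
card-ones (suc n) rewrite Σv-0 n = trans (+-identityʳ _) (card-ones n)

card-weight1 : ∀ n → card (weight1 {n}) ≡ n
card-weight1 zero = refl
card-weight1 (suc n) = cong₂ _+_ (card-zeros n) (card-weight1 n)

card-weight2 : ∀ {n} g → g ≤ n → 2 * card (weight2 {n} g) + g * (g + 1) ≡ 2 * (g * n)
card-weight2 {n} zero g≤n rewrite Σv-0 n = refl
card-weight2 {suc n} (suc g) (s≤s g≤n) = begin
  2 * (card (weight1 {n}) + w) + (1 + g) * (1 + g + 1)  ≡⟨ cong (λ k → 2 * (k + w) + (1 + g) * (1 + g + 1)) (card-weight1 n) ⟩
  2 * (n + w) + (1 + g) * (1 + g + 1)                   ≡⟨ expand n w g ⟩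
  (2 * w + g * (g + 1)) + (2 * n + 2 * g + 2)           ≡⟨ cong (_+ (2 * n + 2 * g + 2)) (card-weight2 g g≤n) ⟩
  2 * (g * n) + (2 * n + 2 * g + 2)                     ≡⟨ collect n g ⟩
  2 * ((1 + g) * (1 + n))                               ∎
  where
  open ≡-Reasoning
  w = card (weight2 {n} g)
  expand : ∀ n w g → 2 * (n + w) + (1 + g) * (1 + g + 1) ≡ (2 * w + g * (g + 1)) + (2 * n + 2 * g + 2)
  expand = solve-∀
  collect : ∀ n g → 2 * (g * n) + (2 * n + 2 * g + 2) ≡ 2 * ((1 + g) * (1 + n))
  collect = solve-∀

card-coweight1 : ∀ {n} g → g ≤ n → card (coweight1 {n} g) ≡ g
card-coweight1 {n} zero g≤n = Σv-0 n
card-coweight1 {suc n} (suc g) (s≤s g≤n) = trans (cong₂ _+_ (card-coweight1 g g≤n) (card-ones n)) (+-comm g 1)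

-- Adding the sizes of the three pieces gives an upper estimate; equality follows from the lower
-- bound applied to this cut.
card-cut : ∀ {n} g → g ≤ n → 2 * card (cut {n} g) + g * (g + 1) ≤ 2 * (g * (1 + n)) + 2
card-cut {n} g g≤n = begin
  2 * card (cut {n} g) + g * (g + 1)              ≤⟨ +-monoˡ-≤ (g * (g + 1)) (*-monoʳ-≤ 2 (Σv-mono {n} λ v → split (zeros v) (weight2 g v) (coweight1 g v))) ⟩
  2 * Σv {n} (λ v → 𝟙 (zeros v) + (𝟙 (weight2 g v) + 𝟙 (coweight1 g v))) + g * (g + 1)
    ≡⟨ cong (λ k → 2 * k + g * (g + 1)) (trans (Σv-+ (𝟙 ∘ zeros {n}) _)
         (cong₂ _+_ (card-zeros n) (trans (Σv-+ (𝟙 ∘ weight2 {n} g) _) (cong (w +_) (card-coweight1 g g≤n))))) ⟩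
  2 * (1 + (w + g)) + g * (g + 1)                 ≡⟨ regroup w g ⟩
  (2 * w + g * (g + 1)) + (2 + 2 * g)             ≡⟨ cong (_+ (2 + 2 * g)) (card-weight2 g g≤n) ⟩
  2 * (g * n) + (2 + 2 * g)                       ≡⟨ collect n g ⟩
  2 * (g * (1 + n)) + 2                           ∎
  where
  open ≤-Reasoning
  w = card (weight2 {n} g)
  split : ∀ a b c → 𝟙 (a ∨ (b ∨ c)) ≤ 𝟙 a + (𝟙 b + 𝟙 c)
  split true  b     c = s≤s z≤n
  split false true  c = s≤s z≤n
  split false false c = ≤-refl
  regroup : ∀ w g → 2 * (1 + (w + g)) + g * (g + 1) ≡ (2 * w + g * (g + 1)) + (2 + 2 * g)
  regroup = solve-∀
  collect : ∀ n g → 2 * (g * n) + (2 + 2 * g) ≡ 2 * (g * (1 + n)) + 2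
  collect = solve-∀

origin : ∀ {n} → Vertex n
origin = replicate _ false

unit : ∀ {n} → Fin n → Vertex n
unit zero    = true ∷ origin
unit (suc i) = false ∷ unit i

zeros-origin : ∀ n → zeros (origin {n}) ≡ true
zeros-origin zero    = refl
zeros-origin (suc n) = zeros-origin n

weight1-unit : ∀ {n} (i : Fin n) → weight1 (unit i) ≡ true
weight1-unit {suc n} zero    = zeros-origin n
weight1-unit         (suc i) = weight1-unit i

hamming-origin≡1 : ∀ {n} (v : Vertex n) → hamming origin v ≡ 1 → weight1 v ≡ true
hamming-origin≡1 {suc n} (true ∷ v)  h = subst (λ v → zeros v ≡ true) (hamming≡0 origin v (suc-injective h)) (zeros-origin n)
hamming-origin≡1 (false ∷ v) h = hamming-origin≡1 v h

unit-neighbour-Q : ∀ {n g} (i : Fin n) v → toℕ i < g → hamming (unit i) v ≡ 1 → zeros v ≡ true ⊎ weight2 g v ≡ true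
unit-neighbour-Q zero (true ∷ v)  (s≤s _) h = inj₂ (hamming-origin≡1 v h)
unit-neighbour-Q {suc n} zero (false ∷ v) (s≤s _) h =
  inj₁ (subst (λ v → zeros v ≡ true) (hamming≡0 origin v (suc-injective h)) (zeros-origin n))
unit-neighbour-Q (suc i) (true ∷ v)  (s≤s i<g) h =
  inj₂ (subst (λ v → weight1 v ≡ true) (hamming≡0 (unit i) v (suc-injective h)) (weight1-unit i))
unit-neighbour-Q (suc i) (false ∷ v) (s≤s i<g) h = unit-neighbour-Q i v i<g h

ones-complement-origin : ∀ n → ones (complement (origin {n})) ≡ true
ones-complement-origin zero    = refl
ones-complement-origin (suc n) = ones-complement-origin n

coweight1-complement-unit : ∀ {n g} (i : Fin n) → toℕ i < g → coweight1 g (complement (unit i)) ≡ true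
coweight1-complement-unit {suc n} zero    (s≤s _)   = ones-complement-origin n
coweight1-complement-unit         (suc i) (s≤s i<g) = coweight1-complement-unit i i<g

unit-neighbour∈cut : ∀ {n g} (i : Fin n) v → toℕ i < g → AdjFQ (unit i) v → cut g v ≡ true
unit-neighbour∈cut {g = g} i v i<g (inj₁ h) with unit-neighbour-Q i v i<g h
... | inj₁ z rewrite z = refl
... | inj₂ w rewrite w = ∨-zeroʳ (zeros v)
unit-neighbour∈cut {g = g} i _ i<g (inj₂ refl)
  rewrite coweight1-complement-unit i i<g | ∨-zeroʳ (weight2 g (complement (unit i))) = ∨-zeroʳ _

∨-false : ∀ {a b c} → a ≡ false → b ≡ false → c ≡ false → a ∨ (b ∨ c) ≡ false
∨-false refl refl refl = refl

zeros-unit : ∀ {n} (i : Fin n) → zeros (unit i) ≡ false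
zeros-unit zero    = refl
zeros-unit (suc i) = zeros-unit i

weight1-origin : ∀ n → weight1 (origin {n}) ≡ false
weight1-origin zero    = refl
weight1-origin (suc n) = weight1-origin n

weight2-unit : ∀ {n} g (i : Fin n) → weight2 g (unit i) ≡ false
weight2-unit zero    i = refl
weight2-unit {suc n} (suc g) zero = weight1-origin n
weight2-unit (suc g) (suc i) = weight2-unit g i

coweight1-origin : ∀ {n} g → coweight1 g (origin {2 + n}) ≡ false
coweight1-origin zero    = refl
coweight1-origin (suc g) = refl

ones-unit : ∀ {n} (i : Fin (2 + n)) → ones (unit i) ≡ false
ones-unit zero    = refl
ones-unit (suc i) = refl

coweight1-unit : ∀ {n} g (i : Fin (3 + n)) → coweight1 g (unit i) ≡ false
coweight1-unit zero    i       = refl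
coweight1-unit (suc g) zero    = coweight1-origin g
coweight1-unit (suc g) (suc i) = ones-unit i

unit∉cut : ∀ {n} g (i : Fin (3 + n)) → cut g (unit i) ≡ false
unit∉cut g i = ∨-false (zeros-unit i) (weight2-unit g i) (coweight1-unit g i)

-- Represents a component besides the isolated unit vectors. Its weight is three, and in dimension
-- at least 5 it has at least two zeros, so no clause of `cut` captures it.
far : ∀ {n} → Vertex (5 + n)
far = true ∷ true ∷ true ∷ origin

far∉cut : ∀ {n} g → cut g (far {n}) ≡ false
far∉cut g = ∨-false refl (w g) (cw g)
  where
  w : ∀ g → weight2 g far ≡ false
  w zero    = refl
  w (suc g) = refl
  cw : ∀ g → coweight1 g far ≡ false
  cw zero                = refl
  cw (suc zero)          = refl
  cw (suc (suc zero))    = refl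
  cw (suc (suc (suc g))) = coweight1-origin g

far≢unit : ∀ {n} (i : Fin (5 + n)) → far ≢ unit i
far≢unit zero    ()
far≢unit (suc i) ()

unit-injective : ∀ {n} (i j : Fin n) → unit i ≡ unit j → i ≡ j
unit-injective zero    zero    _ = refl
unit-injective (suc i) (suc j) e = cong suc (unit-injective i j (∷-injectiveʳ e))

Reach-from-isolated : ∀ {n} {S : VertexSet n} {u v} → (∀ w → AdjFQ u w → S w ≡ true) → Reach S u v → v ≡ u
Reach-from-isolated isolated (here _) = refl
Reach-from-isolated isolated (step r w~v Sv) with Reach-from-isolated isolated r
... | refl with () ← trans (sym (isolated _ w~v)) Sv

Reach-to-isolated : ∀ {n} {S : VertexSet n} {u v} → (∀ w → AdjFQ v w → S w ≡ true) → Reach S u v → u ≡ v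
Reach-to-isolated isolated (here _) = refl
Reach-to-isolated isolated (step {w} {v} r w~v Sv) with () ← trans (sym (isolated w (AdjFQ-sym w v w~v))) (Reach-avoids r)

cut-components : ∀ {n} g → g ≤ 5 + n → IsComponentCut (suc g) (cut {5 + n} g)
cut-components {n} g g≤ = x , x∉cut , apart
  where
  e : Fin g → Fin (5 + n)
  e i = inject≤ i g≤
  x : Fin (suc g) → Vertex (5 + n)
  x zero    = far
  x (suc i) = unit (e i)
  x∉cut : ∀ i → cut g (x i) ≡ false
  x∉cut zero    = far∉cut g
  x∉cut (suc i) = unit∉cut g (e i)
  isolated : ∀ i w → AdjFQ (unit (e i)) w → cut g w ≡ true
  isolated i w = unit-neighbour∈cut (e i) w (≤-trans (≤-reflexive (cong suc (Finₚ.toℕ-inject≤ i g≤))) (Finₚ.toℕ<n i))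
  apart : ∀ i j → i ≢ j → ¬ Reach (cut g) (x i) (x j)
  apart zero    zero    i≢j _ = i≢j refl
  apart zero    (suc j) i≢j r = far≢unit (e j) (Reach-to-isolated (isolated j) r)
  apart (suc i) zero    i≢j r = far≢unit (e i) (Reach-from-isolated (isolated i) r)
  apart (suc i) (suc j) i≢j r = i≢j (cong suc (sym (Finₚ.inject≤-injective g≤ g≤ j i
    (unit-injective (e j) (e i) (Reach-from-isolated (isolated i) r)))))

-- Comparison with the closed formula.

triangular : ∀ g → ∃ λ T → g * (g + 1) ≡ T * 2
triangular zero    = 0 , refl
triangular (suc g) with triangular g
... | T , e = T + (g + 1) , (begin
  (1 + g) * (1 + g + 1)      ≡⟨ expand g ⟩
  g * (g + 1) + 2 * (g + 1)  ≡⟨ cong (_+ 2 * (g + 1)) e ⟩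
  T * 2 + 2 * (g + 1)        ≡⟨ collect T g ⟩
  (T + (g + 1)) * 2          ∎)
  where
  open ≡-Reasoning
  expand : ∀ g → (1 + g) * (1 + g + 1) ≡ g * (g + 1) + 2 * (g + 1)
  expand = solve-∀
  collect : ∀ T g → T * 2 + 2 * (g + 1) ≡ (T + (g + 1)) * 2
  collect = solve-∀

-- No subtraction is truncated in the closed formula, and its division by 2 is exact.
formula : ∀ n g → g ≤ n → 2 * ((g * (n + 1) ∸ (g * (g + 1)) / 2) + 1) + g * (g + 1) ≡ 2 * (g * (1 + n)) + 2
formula n g g≤n with triangular g
... | T , e = begin
  2 * ((X ∸ (g * (g + 1)) / 2) + 1) + g * (g + 1)  ≡⟨ cong (λ k → 2 * ((X ∸ k / 2) + 1) + k) e ⟩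
  2 * ((X ∸ T * 2 / 2) + 1) + T * 2                ≡⟨ cong (λ k → 2 * ((X ∸ k) + 1) + T * 2) (m*n/n≡m T 2) ⟩
  2 * ((X ∸ T) + 1) + T * 2                        ≡⟨ regroup (X ∸ T) T ⟩
  2 * ((X ∸ T) + T) + 2                            ≡⟨ cong (λ k → 2 * k + 2) (m∸n+n≡m T≤X) ⟩
  2 * X + 2                                        ≡⟨ cong (λ k → 2 * (g * k) + 2) (+-comm n 1) ⟩
  2 * (g * (1 + n)) + 2                            ∎
  where
  open ≡-Reasoning
  X = g * (n + 1)
  regroup : ∀ x T → 2 * (x + 1) + T * 2 ≡ 2 * (x + T) + 2
  regroup = solve-∀
  T≤X : T ≤ X
  T≤X = ≤-trans (m≤m*n T 2) (≤-trans (≤-reflexive (sym e)) (*-monoʳ-≤ g (+-monoˡ-≤ 1 g≤n)))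

theorem2p11 : (n g : ℕ) → 8 ≤ n → 1 ≤ g → g ≤ n ∸ 1 →
    ComponentConnectivityFQ≡ n (suc g) ((g * (n + 1) ∸ (g * (g + 1)) / 2) + 1)
theorem2p11 (suc m) g (s≤s 7≤m) 1≤g g≤m = (cut g , components , ≤-antisym upper (lower (cut g) components)) , lower
  where
  g≤n : g ≤ suc m
  g≤n = ≤-trans g≤m (n≤1+n m)

  M : ℕ
  M = (g * (suc m + 1) ∸ (g * (g + 1)) / 2) + 1

  lower : (S : VertexSet (suc m)) → IsComponentCut (suc g) S → M ≤ size S
  lower S isCut = *-cancelˡ-≤ 2 (+-cancelʳ-≤ (g * (g + 1)) _ _ (begin
    2 * M + g * (g + 1)             ≡⟨ formula (suc m) g g≤n ⟩
    2 * (g * (2 + m)) + 2           ≤⟨ cut-lower-bound 7≤m 1≤g g≤m S isCut ⟩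
    2 * card S + g * (g + 1)        ≡⟨ cong (λ k → 2 * k + g * (g + 1)) (sym (size≡card S)) ⟩
    2 * size S + g * (g + 1)        ∎))
    where open ≤-Reasoning

  upper : size (cut {suc m} g) ≤ M
  upper = *-cancelˡ-≤ 2 (+-cancelʳ-≤ (g * (g + 1)) _ _ (begin
    2 * size (cut {suc m} g) + g * (g + 1)  ≡⟨ cong (λ k → 2 * k + g * (g + 1)) (size≡card (cut {suc m} g)) ⟩
    2 * card (cut {suc m} g) + g * (g + 1)  ≤⟨ card-cut g g≤n ⟩
    2 * (g * (2 + m)) + 2                   ≡⟨ sym (formula (suc m) g g≤n) ⟩
    2 * M + g * (g + 1)                     ∎))
    where open ≤-Reasoning

  components : IsComponentCut (suc g) (cut {suc m} g)
  components with ≤⇒+ (≤-trans (m≤m+n 4 3) 7≤m)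
  ... | _ , refl = cut-components g g≤n
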